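{- Let $k,i$ be positive integers and let $G$ be a finite simple graph with $m=c_k(G)\ge1$. Write $m=\binom{n_k}{k}+\binom{n_{k-1}}{k-1}+\sum_{j=1}^{t}\binom{a_{k-j}}{k-j}$ as the unique representation with $t\ge0$, $n_k>n_{k-1}\ge k-2$, $a_{k-1}>\dots>a_{k-t}\ge k-t>0$ and $\binom{n_{k-1}}{k-2}>\sum_{j=1}^t\binom{a_{k-j}}{k-j}$; and, when $n_k>k$, write $m=\sum_{j=0}^{s}\binom{b_{k-j}}{k-j}_{n_k-1-j}$ as the unique Turán representation with $r=n_k-1$. Then $$c_{k+i}(G)\le\max\Big\{\binom{n_k}{k+i}+\binom{n_{k-1}}{k+i-1}+\sum_{j=1}^t\binom{a_{k-j}}{k+i-j},\ \ \sum_{j=0}^s\binom{b_{k-j}}{k+i-j}_{n_k-1-j}\Big\},$$ where if $n_k=k$ the second expression is undefined and the maximum is understood as the first expression.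
   Context: $c_i(G)$ is the number of $i$-vertex cliques of $G$; $\binom{n}{j}=0$ if $j>n$ or $j<0$. Turán graph $T_{n,r}$: $n$ vertices partitioned into $r$ parts as evenly as possible, adjacent iff in different parts; $\binom{n}{k}_r$ denotes the number of $k$-vertex cliques of $T_{n,r}$. For $r\ge k$, each positive integer $m$ has a unique Turán representation $m=\sum_{j=0}^{s}\binom{b_{k-j}}{k-j}_{r-j}$ with $b_{k-j}-\lfloor b_{k-j}/(r-j)\rfloor>b_{k-j-1}$ for $0\le j<s$ and $b_{k-s}\ge k-s>0$. In the first representation, $t=0$ means no $a$-terms. -}

module Defs where

open import Data.Nat using (ℕ; zero; suc; _+_; _∸_; _≡ᵇ_; _≤ᵇ_; _/_; _%_; _<ᵇ_)
open import Data.Nat.Combinatorics using (_C_)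
open import Data.Bool using (Bool; true; false; not; _∧_; _∨_; if_then_else_)
open import Data.Fin using (Fin; toℕ)
open import Data.Fin.Subset using (Subset; ∣_∣; inside; outside)
open import Data.Vec using (Vec; []; _∷_; lookup)
open import Data.List using (List; []; _∷_; [_]; map; _++_; length; filterᵇ; allFin)
open import Relation.Binary.PropositionalEquality using (_≡_; refl; cong)

record Graph : Set where
  field
    n      : ℕ
    adj    : Fin n → Fin n → Bool
    sym    : ∀ u v → adj u v ≡ adj v u
    irrefl : ∀ v → adj v v ≡ false
open Graph public

allSubsets : ∀ n → List (Subset n)
allSubsets zero    = [ [] ]
allSubsets (suc n) = map (outside ∷_) (allSubsets n) ++ map (inside ∷_) (allSubsets n)

allᵇ : {A : Set} → (A → Bool) → List A → Bool
allᵇ P []       = true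
allᵇ P (x ∷ xs) = P x ∧ allᵇ P xs

isClique : (G : Graph) → Subset (n G) → Bool
isClique G p =
  allᵇ (λ u → allᵇ (λ v →
      not (lookup p u ∧ lookup p v ∧ (toℕ u <ᵇ toℕ v)) ∨ adj G u v)
    (allFin (n G))) (allFin (n G))

c : ℕ → Graph → ℕ
c k G = length (filterᵇ (λ p → (∣ p ∣ ≡ᵇ k) ∧ isClique G p) (allSubsets (n G)))

-- Turán graph T_{N,r}: vertex v lies in part (v mod r); this splits the
-- N vertices into r parts as evenly as possible. Adjacent iff different parts.
-- (The convention for r = 0 -- every vertex its own part -- is never used.)

part : ℕ → ℕ → ℕ
part zero    a = a
part (suc r) a = a % suc r

≡ᵇ-sym : ∀ a b → (a ≡ᵇ b) ≡ (b ≡ᵇ a)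
≡ᵇ-sym zero zero = refl
≡ᵇ-sym zero (suc b) = refl
≡ᵇ-sym (suc a) zero = refl
≡ᵇ-sym (suc a) (suc b) = ≡ᵇ-sym a b

≡ᵇ-refl : ∀ a → (a ≡ᵇ a) ≡ true
≡ᵇ-refl zero = refl
≡ᵇ-refl (suc a) = ≡ᵇ-refl a

Turán : ℕ → ℕ → Graph
Turán N r = record
  { n      = N
  ; adj    = λ u v → not (part r (toℕ u) ≡ᵇ part r (toℕ v))
  ; sym    = λ u v → cong not (≡ᵇ-sym (part r (toℕ u)) (part r (toℕ v)))
  ; irrefl = λ v → cong not (≡ᵇ-refl (part r (toℕ v)))
  }

turanC : ℕ → ℕ → ℕ → ℕ
turanC N k r = c k (Turán N r)

chooseSub : ℕ → ℕ → ℕ → ℕ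
chooseSub N k d = if d ≤ᵇ k then N C (k ∸ d) else 0

-- floor division with (unused) convention a / 0 = 0
_div_ : ℕ → ℕ → ℕ
a div zero  = 0
a div suc q = a / suc q

sum1 : ℕ → (ℕ → ℕ) → ℕ
sum1 zero    f = 0
sum1 (suc t) f = sum1 t f + f (suc t)

sum0 : ℕ → (ℕ → ℕ) → ℕ
sum0 zero    f = f 0
sum0 (suc s) f = sum0 s f + f (suc s)

{-# OPTIONS --safe #-}
module Submission where

-- Let N = n_k and n' = n_{k-1}.
--
-- If G has no N-clique, its clique numbers satisfy the coloured Kruskal–Katona bound with r = N - 1
-- colours. For a vertex v with the most k-cliques in its neighbourhood, remove the non-neighbours of v
-- one at a time; all links that occur have no r-clique, so by induction on r their shadows are at least
-- those of colex initial segments of the infinite (r-1)-partite Turán graph. Reassembling these gives an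
-- r-partite configuration (a "cone"), whose shadow is compared numerically with the colex one.
--
-- If G has an N-clique K, add the other vertices one at a time. Each has at most n' neighbours in K,
-- since c_k(G) < C(N,k) + C(n'+1,k-1). If every new vertex contributes fewer than C(n',k-1) k-cliques,
-- Kruskal–Katona in the links and the exchange property suffice. A vertex contributing more has a link
-- with at most C(n',k) + δ k-cliques, where δ is the number of k-cliques outside K already present, so
-- the k-cliques of the link in excess of C(n',k) form a cone over these.

open import Defs hiding (n; adj; sym; irrefl)
open import Data.Bool using (Bool; true; false; not; _∧_; _∨_; if_then_else_)
open import Data.Bool.Properties using (T?; T-≡; ∧-assoc; ∧-comm; ∧-zeroʳ)
open import Data.Empty using (⊥-elim)
open import Data.Fin using (Fin; zero; suc; toℕ)
open import Data.Fin.Subset using (Subset; ∣_∣; inside; outside)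
open import Data.List using (List; []; _∷_; _++_; map; length; replicate; filterᵇ; allFin; tabulate; applyDownFrom)
open import Data.List.Membership.Propositional using (_∈_)
open import Data.List.Membership.Propositional.Properties using (∈-∃++)
open import Data.List.Properties using (filter-all; filter-++; length-filter; length-++; length-map; map-tabulate)
open import Data.List.Relation.Binary.Permutation.Propositional using (_↭_; refl; prep; swap; ↭-refl; ↭-sym; ↭-trans) renaming (trans to ↭-step)
open import Data.List.Relation.Binary.Permutation.Propositional.Properties using (filter-↭; shift; All-resp-↭; ++⁺ˡ; ++-comm; ++-assoc)
open import Data.List.Relation.Binary.Sublist.Propositional using (_⊆_; []; _∷_; _∷ʳ_; ⊆-refl; ⊆-trans)
open import Data.List.Relation.Binary.Sublist.Propositional.Properties using (filter⁺; filter-⊆)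
open import Data.List.Relation.Unary.All as All using (All; []; _∷_)
import Data.List.Relation.Unary.All.Properties as All
open import Data.List.Relation.Unary.AllPairs as AllPairs using (AllPairs; []; _∷_)
import Data.List.Relation.Unary.AllPairs.Properties as AllPairs
open import Data.List.Relation.Unary.Any using (here; there)
open import Data.Nat
open import Data.Nat.Combinatorics using (_C_; nCk+nC[k+1]≡[n+1]C[k+1])
open import Data.Nat.DivMod using (m≡m%n+[m/n]*n; m%n<n; m<n⇒m%n≡m; [m+kn]%n≡m%n; m<n⇒m/n≡0; m*n/n≡m; +-distrib-/-∣ʳ)
open import Data.Nat.Divisibility using (divides-refl)
open import Data.Nat.Properties
open import Data.Nat.Tactic.RingSolver using (solve-∀)
open import Data.Product using (_×_; _,_; ∃-syntax; proj₁; proj₂)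
open import Data.Sum using (_⊎_; inj₁; inj₂; [_,_]′)
open import Data.Vec using ([]; _∷_; lookup)
open import Function using (_∘_; id)
open import Function.Bundles using (Equivalence)
open import Relation.Binary.Definitions using (tri<; tri≈; tri>)
open import Relation.Binary.PropositionalEquality hiding ([_])

+-rotate : ∀ a b c → a + b + c ≡ a + (c + b)
+-rotate = solve-∀

+-suc-* : ∀ t q x → t + q * x + x ≡ t + suc q * x
+-suc-* = solve-∀

-- Turán numbers and colex shadows

-- With r + 1 parts, the number of vertices v < b with v ≢ b (mod r + 1).
nbrs : ℕ → ℕ → ℕ
nbrs r b = b ∸ b / suc r

-- tur r k b is the number of k-cliques of T_{b,r}; the recursion removes the last vertex.
tur : ℕ → ℕ → ℕ → ℕ
tur r       zero    b       = 1
tur zero    (suc k) b       = 0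
tur (suc r) (suc k) zero    = 0
tur (suc r) (suc k) (suc b) = tur (suc r) (suc k) b + tur r k (nbrs r b)

-- The shadow of a full Turán graph. The value 0 at `k = 0` lets `tur-suc` hold for every `k`.
tur⁻ : ℕ → ℕ → ℕ → ℕ
tur⁻ r zero    b = 0
tur⁻ r (suc k) b = tur r k b

tur-suc : ∀ r k b → tur (suc r) k b + tur⁻ r k (nbrs r b) ≡ tur (suc r) k (suc b)
tur-suc r zero    b = refl
tur-suc r (suc k) b = refl

/-rem : ∀ r q ρ → ρ ≤ r → (ρ + q * suc r) / suc r ≡ q
/-rem r q ρ ρ≤r = trans (+-distrib-/-∣ʳ ρ (divides-refl q))
  (cong₂ _+_ (m<n⇒m/n≡0 (s≤s ρ≤r)) (m*n/n≡m q (suc r)))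

nbrs-rem : ∀ r q ρ → ρ ≤ r → nbrs r (ρ + q * suc r) ≡ ρ + q * r
nbrs-rem r q ρ ρ≤r rewrite /-rem r q ρ ρ≤r =
  trans (cong (_∸ q) (lemma r q ρ)) (m+n∸n≡m (ρ + q * r) q)
  where
  lemma : ∀ r q ρ → ρ + q * suc r ≡ ρ + q * r + q
  lemma = solve-∀

%-rem : ∀ r q ρ → ρ ≤ r → (ρ + q * suc r) % suc r ≡ ρ
%-rem r q ρ ρ≤r = trans ([m+kn]%n≡m%n ρ q (suc r)) (m<n⇒m%n≡m (s≤s ρ≤r))

data Rem (r : ℕ) : ℕ → Set where
  rem : ∀ q ρ → ρ ≤ r → Rem r (ρ + q * suc r)

remView : ∀ r b → Rem r b
remView r b = subst (Rem r) (sym (m≡m%n+[m/n]*n b (suc r)))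
  (rem (b / suc r) (b % suc r) (m<1+n⇒m≤n (m%n<n b (suc r))))

-- Either vertex `b` has the last colour, so that deleting this colour class removes it too
-- (`stay`), or it has a smaller colour and keeps its place in its round after the deletion
-- (`grow`).
data Next : ℕ → ℕ → Set where
  stay : ∀ {r b} → nbrs r (suc b) ≡ nbrs r b → suc b / suc r ≡ suc (b / suc r) →
         b % suc r ≡ r → Next r b
  grow : ∀ {r b} → nbrs (suc r) (suc b) ≡ suc (nbrs (suc r) b) →
         suc b / suc (suc r) ≡ b / suc (suc r) →
         nbrs (suc r) b / suc r ≡ b / suc (suc r) →
         nbrs (suc r) b % suc r ≡ b % suc (suc r) → Next (suc r) b

next : ∀ r b → Next r b
next r b with remView r b
next r .(ρ + q * suc r) | rem q ρ ρ≤r with m≤n⇒m<n∨m≡n ρ≤r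
next r .(ρ + q * suc r) | rem q ρ ρ≤r | inj₂ refl = stay
  (trans (nbrs-rem r (suc q) 0 z≤n) (sym (nbrs-rem r q r ≤-refl)))
  (trans (/-rem r (suc q) 0 z≤n) (cong suc (sym (/-rem r q r ≤-refl))))
  (%-rem r q r ≤-refl)
next (suc r) .(ρ + q * suc (suc r)) | rem q ρ ρ≤r | inj₁ (s≤s ρ≤r′) = grow
  (trans (nbrs-rem (suc r) q (suc ρ) (s≤s ρ≤r′)) (cong suc (sym g≡)))
  (trans (/-rem (suc r) q (suc ρ) (s≤s ρ≤r′)) (sym (/-rem (suc r) q ρ ρ≤r)))
  (trans (cong (_/ suc r) g≡) (trans (/-rem r q ρ ρ≤r′) (sym (/-rem (suc r) q ρ ρ≤r))))
  (trans (cong (_% suc r) g≡) (trans (%-rem r q ρ ρ≤r′) (sym (%-rem (suc r) q ρ ρ≤r))))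
  where
  g≡ : nbrs (suc r) (ρ + q * suc (suc r)) ≡ ρ + q * suc r
  g≡ = nbrs-rem (suc r) q ρ ρ≤r

≤-steps : (f : ℕ → ℕ) → (∀ b → f b ≤ f (suc b)) → ∀ {b b′} → b ≤ b′ → f b ≤ f b′
≤-steps f f↑ {b} {b′} b≤b′ = go (≤⇒≤′ b≤b′)
  where
  go : ∀ {b′} → b ≤′ b′ → f b ≤ f b′
  go ≤′-refl     = ≤-refl
  go (≤′-step p) = ≤-trans (go p) (f↑ _)

nbrs-mono : ∀ r {b b′} → b ≤ b′ → nbrs r b ≤ nbrs r b′
nbrs-mono r = ≤-steps (nbrs r) nbrs↑
  where
  nbrs↑ : ∀ b → nbrs r b ≤ nbrs r (suc b)
  nbrs↑ b with next r b
  ... | stay e _ _     = ≤-reflexive (sym e)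
  ... | grow e _ _ _ = ≤-trans (n≤1+n _) (≤-reflexive (sym e))

tur-mono : ∀ r k {b b′} → b ≤ b′ → tur r k b ≤ tur r k b′
tur-mono r k = ≤-steps (tur r k) (tur↑ r k)
  where
  tur↑ : ∀ r k b → tur r k b ≤ tur r k (suc b)
  tur↑ r       zero    b = ≤-refl
  tur↑ zero    (suc k) b = z≤n
  tur↑ (suc r) (suc k) b = m≤m+n _ _

block-mono : ∀ r k {b b′} → b ≤ b′ → tur r k (nbrs r b) ≤ tur r k (nbrs r b′)
block-mono r k b≤b′ = tur-mono r k (nbrs-mono r b≤b′)

-- Splits off one of the r + 1 parts, the one of size ⌊b / (r + 1)⌋.
tur-slice : ∀ r k b → tur (suc r) k b ≡ tur r k (nbrs r b) + b / suc r * tur⁻ r k (nbrs r b)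
tur-slice r zero b = cong suc (sym (*-zeroʳ (b / suc r)))
tur-slice zero    (suc k) zero = refl
tur-slice (suc r) (suc k) zero = refl
tur-slice r (suc k) (suc b) with next r b
... | stay g≡ q≡ _ = begin
  tur (suc r) (suc k) b + X                          ≡⟨ cong (_+ X) (tur-slice r (suc k) b) ⟩
  tur r (suc k) (nbrs r b) + b / suc r * X + X       ≡⟨ +-suc-* (tur r (suc k) (nbrs r b)) (b / suc r) X ⟩
  tur r (suc k) (nbrs r b) + suc (b / suc r) * X     ≡⟨ cong₂ (λ G q → tur r (suc k) G + q * tur r k G) (sym g≡) (sym q≡) ⟩
  tur r (suc k) (nbrs r (suc b)) + suc b / suc r * tur r k (nbrs r (suc b)) ∎
  where
  open ≡-Reasoning
  X = tur r k (nbrs r b)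
tur-slice (suc r) (suc k) (suc b) | grow g≡ q≡ q′≡ _ = begin
  tur (suc (suc r)) (suc k) b + X        ≡⟨ cong₂ _+_ (tur-slice (suc r) (suc k) b) X≡ ⟩
  Y + q * X + (A + q * B)                ≡⟨ lemma Y q X A B ⟩
  (Y + A) + q * (X + B)                  ≡⟨ cong (λ x → (Y + A) + q * x) (tur-suc r k G) ⟩
  tur (suc r) (suc k) (suc G) + q * tur (suc r) k (suc G)
    ≡⟨ cong₂ (λ G q → tur (suc r) (suc k) G + q * tur (suc r) k G) (sym g≡) (sym q≡) ⟩
  tur (suc r) (suc k) (nbrs (suc r) (suc b)) + suc b / suc (suc r) * tur (suc r) k (nbrs (suc r) (suc b)) ∎
  where
  open ≡-Reasoning
  G = nbrs (suc r) b
  q = b / suc (suc r)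
  X = tur (suc r) k G
  Y = tur (suc r) (suc k) G
  A = tur r k (nbrs r G)
  B = tur⁻ r k (nbrs r G)
  -- The new vertex lies outside the part split off, so its neighbourhood again has a part of size
  -- `q`.
  X≡ : X ≡ A + q * B
  X≡ = trans (tur-slice r k G) (cong (λ q → A + q * B) q′≡)
  lemma : ∀ y q x a b → y + q * x + (a + q * b) ≡ (y + a) + q * (x + b)
  lemma = solve-∀

-- Sh r k u s says that the first u k-cliques (in colex order) of the infinite Turán graph with
-- r parts exist and contain at most s (k-1)-cliques; step peels off the largest vertex b.
data Sh : ℕ → ℕ → ℕ → ℕ → Set where
  none : ∀ {r k s} → Sh r k 0 s
  unit : ∀ {r s} → Sh r 0 1 s
  step : ∀ {r k u s} b y s′ → u ≡ tur (suc r) (suc k) b + y → 1 ≤ y → y ≤ tur r k (nbrs r b) →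
         Sh r k y s′ → tur (suc r) k b + s′ ≤ s → Sh (suc r) (suc k) u s

Sh-≡ : ∀ {r k u u′ s} → u ≡ u′ → Sh r k u s → Sh r k u′ s
Sh-≡ refl S = S

Sh-mono : ∀ {r k u s s′} → s ≤ s′ → Sh r k u s → Sh r k u s′
Sh-mono s≤s′ none = none
Sh-mono s≤s′ unit = unit
Sh-mono s≤s′ (step b y t e 1≤y y≤ S le) = step b y t e 1≤y y≤ S (≤-trans le s≤s′)

Sh-full : ∀ r k b {u} → u ≤ tur r k b → Sh r k u (tur⁻ r k b)
Sh-full r       zero    b {zero}  u≤ = none
Sh-full r       zero    b {suc zero} u≤ = unit
Sh-full r       zero    b {suc (suc u)} (s≤s ())
Sh-full zero    (suc k) b       z≤n = none
Sh-full (suc r) (suc k) zero    z≤n = none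
Sh-full (suc r) (suc k) (suc b) {u} u≤ = [
  (λ p → Sh-mono (tur-mono (suc r) k (n≤1+n b)) (Sh-full (suc r) (suc k) b p)) ,
  (λ p → step b (u ∸ tur (suc r) (suc k) b) (tur⁻ r k (nbrs r b))
    (sym (m+[n∸m]≡n (<⇒≤ p))) (m<n⇒0<n∸m p) (m≤n+o⇒m∸n≤o u _ u≤)
    (Sh-full r k (nbrs r b) (m≤n+o⇒m∸n≤o u _ u≤)) (≤-reflexive (tur-suc r k b)))
  ]′ (≤-<-connex u (tur (suc r) (suc k) b))

-- `step` asks for `1 ≤ y`, so that `u` determines the top vertex; constructions also need an empty
-- top block.
Sh-step : ∀ {r k s} b y s′ → y ≤ tur r k (nbrs r b) → Sh r k y s′ → tur (suc r) k b + s′ ≤ s →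
          Sh (suc r) (suc k) (tur (suc r) (suc k) b + y) s
Sh-step {r} {k} b zero s′ y≤ S le = Sh-mono (≤-trans (m≤m+n _ s′) le)
  (Sh-full (suc r) (suc k) b (≤-reflexive (+-identityʳ _)))
Sh-step b (suc y) s′ y≤ S le = step b (suc y) s′ refl (s≤s z≤n) y≤ S le

Sh-down : ∀ {r k u u′ s} → Sh r k u s → u′ ≤ u → Sh r k u′ s
Sh-down none z≤n = none
Sh-down unit z≤n = none
Sh-down unit (s≤s z≤n) = unit
Sh-down {suc r} {suc k} {u} {u′} (step b y s′ refl 1≤y y≤ S le) u′≤u
  with ≤-<-connex u′ (tur (suc r) (suc k) b)
... | inj₁ p = Sh-mono (≤-trans (m≤m+n _ s′) le) (Sh-full (suc r) (suc k) b p)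
... | inj₂ p = Sh-≡ (m+[n∸m]≡n (<⇒≤ p))
  (Sh-step b _ s′ (≤-trans y′≤y y≤) (Sh-down S y′≤y) le)
  where
  y′≤y : u′ ∸ tur (suc r) (suc k) b ≤ y
  y′≤y = m≤n+o⇒m∸n≤o u′ _ u′≤u

Sh-bound : ∀ {r k u s} → Sh r k u s → ∃[ b ] u ≤ tur r k b
Sh-bound none = 0 , z≤n
Sh-bound unit = 0 , ≤-refl
Sh-bound (step b y s′ refl 1≤y y≤ S le) = suc b , +-monoʳ-≤ _ y≤

Sh-pos : ∀ {r k u s} → Sh r (suc k) u s → 1 ≤ u → 1 ≤ s
Sh-pos {k = zero}  (step b y s′ e 1≤y y≤ S le) _ = ≤-trans (s≤s z≤n) le
Sh-pos {k = suc k} (step b y s′ e 1≤y y≤ S le) _ = ≤-trans (Sh-pos S 1≤y) (m+n≤o⇒n≤o _ le)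

-- The exchange property

-- Moving mass from the smaller to the larger of two initial segments, up to a full Turán graph,
-- does not increase the total shadow.
Merge : ℕ → ℕ → Set
Merge r k = ∀ b {a c s t} → a ≤ tur r k b → c ≤ tur r k b → Sh r k a s → Sh r k c t →
  (a + c ≤ tur r k b → Sh r k (a + c) (s + t)) ×
  (tur r k b < a + c → ∃[ v ] Sh r k (a + c ∸ tur r k b) v × tur⁻ r k b + v ≤ s + t)

-- A segment with top vertex `b₀` stays within the full graph on `suc b₀` vertices.
block-index : ∀ r k {b b₀ y} → y ≤ tur r k (nbrs r b₀) →
  tur (suc r) (suc k) b < tur (suc r) (suc k) b₀ + y → b ≤ b₀
block-index r k y≤ lt = ≮⇒≥ λ b₀<b →
  <⇒≱ lt (≤-trans (+-monoʳ-≤ _ y≤) (tur-mono (suc r) (suc k) b₀<b))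

block-index′ : ∀ r k b {b₀ y} → 1 ≤ y → tur (suc r) (suc k) b₀ + y ≤ tur (suc r) (suc k) (suc b) → b₀ ≤ b
block-index′ r k b {b₀} 1≤y u≤ = ≮⇒≥ λ b<b₀ →
  <⇒≱ (≤-trans (≤-reflexive (+-comm 1 _)) (+-monoʳ-≤ _ 1≤y)) (≤-trans u≤ (tur-mono (suc r) (suc k) b<b₀))

module FromMerge (r k : ℕ) (merge : Merge r k) where

  private
    U V B : ℕ → ℕ
    U = tur (suc r) (suc k)
    V = tur (suc r) k
    B b = tur r k (nbrs r b)

  -- Joins one more vertex to a segment containing the full graph on `b` vertices. By exchange one
  -- level down, its link merges with the top block; what overflows becomes the block of the next
  -- vertex.
  Sh-add : ∀ b {u s x t} → U b ≤ u → V b ≤ s → Sh (suc r) (suc k) u s →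
    x ≤ B b → Sh r k x t → Sh (suc r) (suc k) (u + x) (s + t)
  Sh-add b U≤u V≤s S x≤ X with m≤n⇒m<n∨m≡n U≤u
  Sh-add b U≤u V≤s S x≤ X | inj₂ refl = Sh-step b _ _ x≤ X (+-monoˡ-≤ _ V≤s)
  Sh-add b {x = x} {t} U≤u V≤s (step {s = s} b₀ y s₀ refl 1≤y y≤ Y le) x≤ X | inj₁ U<u
    with block-index r k {b} {b₀} y≤ U<u
  ... | b≤b₀ with ≤-<-connex (y + x) (B b₀)
                | merge (nbrs r b₀) y≤ (≤-trans x≤ (block-mono r k b≤b₀)) Y X
  ... | inj₁ p | m , _ = Sh-≡ (sym (+-assoc (U b₀) y x))
    (Sh-step b₀ (y + x) (s₀ + t) p (m p)
      (≤-trans (≤-reflexive (sym (+-assoc (V b₀) s₀ t))) (+-monoˡ-≤ t le)))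
  ... | inj₂ p | _ , m with m p
  ... | v , Z , v≤ = Sh-≡ u≡
    (Sh-step (suc b₀) z v (≤-trans z≤ (block-mono r k (n≤1+n b₀))) Z shadow≤)
    where
    z = y + x ∸ B b₀
    z≤ : z ≤ B b₀
    z≤ = m≤n+o⇒m∸n≤o (y + x) (B b₀) (+-mono-≤ y≤ (≤-trans x≤ (block-mono r k b≤b₀)))
    u≡ : U b₀ + B b₀ + z ≡ U b₀ + y + x
    u≡ = begin
      U b₀ + B b₀ + z   ≡⟨ +-assoc (U b₀) (B b₀) z ⟩
      U b₀ + (B b₀ + z) ≡⟨ cong (U b₀ +_) (m+[n∸m]≡n (<⇒≤ p)) ⟩
      U b₀ + (y + x)    ≡⟨ sym (+-assoc (U b₀) y x) ⟩
      U b₀ + y + x      ∎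
      where open ≡-Reasoning
    shadow≤ : V (suc b₀) + v ≤ s + t
    shadow≤ = begin
      V (suc b₀) + v                       ≡⟨ cong (_+ v) (sym (tur-suc r k b₀)) ⟩
      V b₀ + tur⁻ r k (nbrs r b₀) + v      ≡⟨ +-assoc (V b₀) _ v ⟩
      V b₀ + (tur⁻ r k (nbrs r b₀) + v)    ≤⟨ +-monoʳ-≤ (V b₀) v≤ ⟩
      V b₀ + (s₀ + t)                      ≡⟨ sym (+-assoc (V b₀) s₀ t) ⟩
      V b₀ + s₀ + t                        ≤⟨ +-monoˡ-≤ t le ⟩
      s + t                                ∎
      where open ≤-Reasoning

  Sh-add-tur : ∀ b {u s} → U b ≤ u → V b ≤ s → Sh (suc r) (suc k) u s →
    ∀ c → c ≤ b → Sh (suc r) (suc k) (u + U c) (s + V c)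
  Sh-add-tur b {u} {s} U≤u V≤s S zero _ = Sh-≡ (sym (+-identityʳ _))
    (Sh-mono (m≤m+n _ _) S)
  Sh-add-tur b {u} {s} U≤u V≤s S (suc c) c<b = subst₂ (Sh _ _) (+-assoc u (U c) (B c))
    (trans (+-assoc s (V c) _) (cong (s +_) (tur-suc r k c)))
    (Sh-add b (≤-trans U≤u (m≤m+n _ _)) (≤-trans V≤s (m≤m+n _ _))
      (Sh-add-tur b U≤u V≤s S c (<⇒≤ c<b)) (block-mono r k (<⇒≤ c<b)) (Sh-full r k (nbrs r c) ≤-refl))

  private
    add-step : ∀ {u s} b → U b ≤ u → V b ≤ s → Sh (suc r) (suc k) u s →
      ∀ c y t {s′} → c ≤ b → y ≤ B c → Sh r k y t → V c + t ≤ s′ →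
      Sh (suc r) (suc k) (u + (U c + y)) (s + s′)
    add-step {u} {s} b U≤u V≤s S c y t c≤b y≤ Y le = Sh-≡ (+-assoc u (U c) y)
      (Sh-mono (≤-trans (≤-reflexive (+-assoc s (V c) t)) (+-monoʳ-≤ s le))
        (Sh-add b (≤-trans U≤u (m≤m+n _ _)) (≤-trans V≤s (m≤m+n _ _))
          (Sh-add-tur b U≤u V≤s S c c≤b) (≤-trans y≤ (block-mono r k c≤b)) Y))

  -- The segment with the smaller top vertex is dissolved into its full graph and its top block, and
  -- both are added to the other segment.
  Sh-+ : ∀ {u s x t} → Sh (suc r) (suc k) u s → Sh (suc r) (suc k) x t → Sh (suc r) (suc k) (u + x) (s + t)
  Sh-+ none X = Sh-mono (m≤n+m _ _) X
  Sh-+ S none = Sh-≡ (sym (+-identityʳ _)) (Sh-mono (m≤m+n _ _) S)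
  Sh-+ {s = s} {t = t} S@(step b y s′ refl 1≤y y≤ Y le) X@(step c z t′ refl 1≤z z≤ Z le′) with ≤-total c b
  ... | inj₁ c≤b = add-step b (m≤m+n _ _) (m+n≤o⇒m≤o _ le) S c z t′ c≤b z≤ Z le′
  ... | inj₂ b≤c = subst₂ (Sh _ _) (+-comm (U c + z) _) (+-comm t s)
    (add-step c (m≤m+n _ _) (m+n≤o⇒m≤o _ le′) X b y s′ b≤c y≤ Y le)

  private
    -- Removing a suffix of U b from the pair (a , U c + y): either the removed part lies in the top
    -- block of both, or y can be moved onto a and the next lower block of U c becomes the top one.
    overflow : ∀ b {a s} c y t → a ≤ U (suc b) → c ≤ b → U c ≤ a → V c ≤ s → Sh (suc r) (suc k) a s →
      y ≤ B c → Sh r k y t → U (suc b) < a + (U c + y) →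
      ∃[ v ] Sh (suc r) (suc k) (a + (U c + y) ∸ U (suc b)) v × V (suc b) + v ≤ s + (V c + t)
    overflow b {a} {s} c y t a≤ c≤b U≤a V≤s S y≤ Y lt with ≤-<-connex (a + y) (U (suc b))
    overflow b {a} {s} zero y t a≤ c≤b U≤a V≤s S y≤ Y lt | inj₁ p = ⊥-elim (<⇒≱ lt p)
    overflow b {a} {s} (suc c) y t a≤ c≤b U≤a V≤s S y≤ Y lt | inj₁ p =
      let v , Z , v≤ = overflow b c (B c) (tur⁻ r k (nbrs r c)) p (<⇒≤ c≤b)
            (≤-trans (≤-trans (m≤m+n (U c) (B c)) U≤a) (m≤m+n a y))
            (≤-trans (≤-trans (tur-mono (suc r) k (n≤1+n c)) V≤s) (m≤m+n s t))
            (Sh-add (suc c) U≤a V≤s S y≤ Y) ≤-refl (Sh-full r k (nbrs r c) ≤-refl)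
            (≤-trans lt (≤-reflexive (reorder a (U (suc c)) y)))
      in v , Sh-≡ (cong (_∸ U (suc b)) (sym (reorder a (U (suc c)) y))) Z ,
         ≤-trans v≤ (≤-reflexive (trans (cong (s + t +_) (tur-suc r k c)) (sym (reorder s (V (suc c)) t))))
      where
      reorder : ∀ a u y → a + (u + y) ≡ a + y + u
      reorder = solve-∀
    -- Since `y` is at most the block of `b`, `a` must exceed `U b`; hence the top vertex of `a` is
    -- `b`, and exchange applies inside that block.
    overflow b {a} {s} c y t a≤ c≤b U≤a V≤s S y≤ Y lt | inj₂ p with
      +-cancelʳ-< (B b) (U b) a (<-≤-trans p (+-monoʳ-≤ a (≤-trans y≤ (block-mono r k c≤b))))
    overflow b c y t a≤ c≤b U≤a V≤s (step {s = s} b₀ x s₀ refl 1≤x x≤ X le) y≤ Y lt | inj₂ p | U<a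
      with ≤-antisym (block-index r k {b} {b₀} x≤ U<a) (block-index′ r k b 1≤x a≤)
    ... | refl with proj₂ (merge (nbrs r b) x≤ (≤-trans y≤ (block-mono r k c≤b)) X Y)
                      (+-cancelˡ-< (U b) _ _ (≤-trans p (≤-reflexive (+-assoc (U b) x y))))
                  | +-cancelˡ-< (U b) _ _ (≤-trans p (≤-reflexive (+-assoc (U b) x y)))
    ... | v , Z , v≤ | B<x+y = V c + v ,
      Sh-≡ (sym w≡) (Sh-step c z v (≤-trans z≤y y≤) Z ≤-refl) , shadow≤
      where
      z = x + y ∸ B b
      z≤y : z ≤ y
      z≤y = m≤n+o⇒m∸n≤o (x + y) (B b) (+-monoˡ-≤ y x≤)
      w≡ : U b + x + (U c + y) ∸ U (suc b) ≡ U c + z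
      w≡ = begin
        U b + x + (U c + y) ∸ (U b + B b)         ≡⟨ cong (_∸ (U b + B b)) (lemma (U b) x (U c) y) ⟩
        U b + (U c + (x + y)) ∸ (U b + B b)       ≡⟨ [m+n]∸[m+o]≡n∸o (U b) _ _ ⟩
        U c + (x + y) ∸ B b                       ≡⟨ +-∸-assoc (U c) (<⇒≤ B<x+y) ⟩
        U c + z                                   ∎
        where
        open ≡-Reasoning
        lemma : ∀ u x c y → u + x + (c + y) ≡ u + (c + (x + y))
        lemma = solve-∀
      shadow≤ : V (suc b) + (V c + v) ≤ s + (V c + t)
      shadow≤ = begin
        V (suc b) + (V c + v)                          ≡⟨ cong (_+ (V c + v)) (sym (tur-suc r k b)) ⟩
        V b + tur⁻ r k (nbrs r b) + (V c + v)          ≡⟨ lemma (V b) (tur⁻ r k (nbrs r b)) (V c) v ⟩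
        V b + V c + (tur⁻ r k (nbrs r b) + v)          ≤⟨ +-monoʳ-≤ (V b + V c) v≤ ⟩
        V b + V c + (s₀ + t)                           ≡⟨ lemma′ (V b) (V c) s₀ t ⟩
        V b + s₀ + (V c + t)                           ≤⟨ +-monoˡ-≤ (V c + t) le ⟩
        s + (V c + t)                                  ∎
        where
        open ≤-Reasoning
        lemma : ∀ a p c v → a + p + (c + v) ≡ a + c + (p + v)
        lemma = solve-∀
        lemma′ : ∀ a c s t → a + c + (s + t) ≡ a + s + (c + t)
        lemma′ = solve-∀

    dual : ∀ b {a c s t} → a ≤ U b → c ≤ U b → Sh (suc r) (suc k) a s → Sh (suc r) (suc k) c t →
      U b < a + c → ∃[ v ] Sh (suc r) (suc k) (a + c ∸ U b) v × V b + v ≤ s + t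
    dual b a≤ c≤ none SC lt = ⊥-elim (<⇒≱ lt c≤)
    dual b {a} a≤ c≤ SA none lt = ⊥-elim (<⇒≱ lt (≤-trans (≤-reflexive (+-identityʳ a)) a≤))
    dual zero a≤ c≤ SA@(step _ _ _ _ _ _ _ _) SC lt = ⊥-elim (<⇒≱ lt (≤-trans (+-mono-≤ a≤ c≤) z≤n))
    dual (suc b) a≤ c≤ SA@(step {s = s} b₁ x s′ refl 1≤x x≤ X le) SC@(step {s = t} c₁ y t′ refl 1≤y y≤ Y le′) lt
      with ≤-total c₁ b₁
    ... | inj₁ c₁≤b₁ =
      let v , Z , v≤ = overflow b c₁ y t′ a≤ (≤-trans c₁≤b₁ (block-index′ r k b 1≤x a≤))
            (≤-trans (tur-mono (suc r) (suc k) c₁≤b₁) (m≤m+n _ _))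
            (≤-trans (tur-mono (suc r) k c₁≤b₁) (m+n≤o⇒m≤o _ le)) SA y≤ Y lt
      in v , Z , ≤-trans v≤ (+-monoʳ-≤ s le′)
    ... | inj₂ b₁≤c₁ =
      let v , Z , v≤ = overflow b b₁ x s′ c≤ (≤-trans b₁≤c₁ (block-index′ r k b 1≤y c≤))
            (≤-trans (tur-mono (suc r) (suc k) b₁≤c₁) (m≤m+n _ _))
            (≤-trans (tur-mono (suc r) k b₁≤c₁) (m+n≤o⇒m≤o _ le′)) SC x≤ X
            (≤-trans lt (≤-reflexive (+-comm (U b₁ + x) _)))
      in v , Sh-≡ (cong (_∸ U (suc b)) (+-comm (U c₁ + y) _)) Z ,
         ≤-trans v≤ (≤-trans (+-monoʳ-≤ t le) (≤-reflexive (+-comm t s)))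

  merge-suc : Merge (suc r) (suc k)
  merge-suc b a≤ c≤ SA SC = (λ _ → Sh-+ SA SC) , dual b a≤ c≤ SA SC

-- Induction on `r` and `k` together: the block of a top vertex is a segment with one part and one
-- dimension less. At `k = 0` there is only the empty clique.
merge : ∀ r k → Merge r k
merge r zero b {zero} {c} a≤ c≤ SA SC = (λ _ → Sh-mono (m≤n+m _ _) SC) , λ lt → ⊥-elim (<⇒≱ lt c≤)
merge r zero b {suc zero} {zero} a≤ c≤ SA SC = (λ _ → unit) , λ lt → ⊥-elim (<⇒≱ lt ≤-refl)
merge r zero b {suc zero} {suc zero} a≤ c≤ SA SC = (λ { (s≤s ()) }) , λ _ → 0 , unit , z≤n
merge r zero b {suc (suc _)} (s≤s ())
merge r zero b {suc zero} {suc (suc _)} a≤ (s≤s ())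
merge zero (suc k) b z≤n z≤n SA SC = (λ _ → none) , λ ()
merge (suc r) (suc k) = FromMerge.merge-suc r k (merge r k)

module Sum (r k : ℕ) = FromMerge r k (merge r k)

-- Shadows of cones

Σ₁ Σ₂ : List (ℕ × ℕ) → ℕ
Σ₁ []             = 0
Σ₁ ((y , s) ∷ ys) = y + Σ₁ ys
Σ₂ []             = 0
Σ₂ ((y , s) ∷ ys) = s + Σ₂ ys

Σ₁-replicate : ∀ m y s ys → Σ₁ (replicate m (y , s) ++ ys) ≡ m * y + Σ₁ ys
Σ₁-replicate zero    y s ys = refl
Σ₁-replicate (suc m) y s ys = trans (cong (y +_) (Σ₁-replicate m y s ys)) (sym (+-assoc y (m * y) _))

Σ₂-replicate : ∀ m y s ys → Σ₂ (replicate m (y , s) ++ ys) ≡ m * s + Σ₂ ys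
Σ₂-replicate zero    y s ys = refl
Σ₂-replicate (suc m) y s ys = trans (cong (s +_) (Σ₂-replicate m y s ys)) (sym (+-assoc s (m * s) _))

Link : ℕ → ℕ → ℕ → ℕ × ℕ → Set
Link r k p (y , s) = y ≤ p × Sh r k y s

-- Over p k-cliques spanning e (k+1)-cliques, new pairwise non-adjacent vertices are
-- joined to initial segments of size y ≤ p of these k-cliques.
Cone : ℕ → ℕ → Set
Cone r k = ∀ h {p e} ys → p ≤ tur r k h → Sh r (suc k) e p → All (Link r k p) ys →
  Sh (suc r) (suc k) (e + Σ₁ ys) (p + Σ₂ ys)

Σ₁-links-zero : ∀ {r k} ys → All (Link r k 0) ys → Σ₁ ys ≡ 0
Σ₁-links-zero []       []               = refl
Σ₁-links-zero (_ ∷ ys) ((z≤n , _) ∷ as) = Σ₁-links-zero ys as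

cone-empty : ∀ {r k e} ys → Sh r (suc k) e 0 → All (Link r k 0) ys → Sh (suc r) (suc k) (e + Σ₁ ys) (0 + Σ₂ ys)
cone-empty {e = zero}  ys E as = Sh-≡ (sym (Σ₁-links-zero ys as)) none
cone-empty {e = suc e} ys E as with Sh-pos E (s≤s z≤n)
... | ()

tur-vertices : ∀ r b → tur (suc r) 1 b ≡ b
tur-vertices r zero    = refl
tur-vertices r (suc b) = trans (+-comm _ 1) (cong suc (tur-vertices r b))

rem-+ : ∀ r q ρ → ρ + q * suc r + q ≡ ρ + q * suc (suc r)
rem-+ = solve-∀

-- The (r+1)-partite Turán graph on h vertices together with ⌊h / (r+1)⌋ + 1 further points joined to
-- all of it is again a Turán graph, with r+2 parts.
tur-star : ∀ r k h → tur (suc (suc r)) k (suc (h + h / suc r)) ≡ tur (suc r) k h + suc (h / suc r) * tur⁻ (suc r) k h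
           × nbrs (suc r) (suc (h + h / suc r)) ≡ suc h
tur-star r k h with remView r h
... | rem q ρ ρ≤r rewrite /-rem r q ρ ρ≤r | rem-+ r q ρ = count , nbrs-rem (suc r) q (suc ρ) (s≤s ρ≤r)
  where
  b = ρ + q * suc (suc r)
  H = ρ + q * suc r
  n≡ : nbrs (suc r) b ≡ H
  n≡ = nbrs-rem (suc r) q ρ (m≤n⇒m≤1+n ρ≤r)
  count : tur (suc (suc r)) k (suc b) ≡ tur (suc r) k H + suc q * tur⁻ (suc r) k H
  count = begin
    tur (suc (suc r)) k (suc b)                         ≡⟨ sym (tur-suc (suc r) k b) ⟩
    tur (suc (suc r)) k b + tur⁻ (suc r) k (nbrs (suc r) b)
      ≡⟨ cong (_+ tur⁻ (suc r) k (nbrs (suc r) b)) (tur-slice (suc r) k b) ⟩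
    tur (suc r) k (nbrs (suc r) b) + b / suc (suc r) * tur⁻ (suc r) k (nbrs (suc r) b) + tur⁻ (suc r) k (nbrs (suc r) b)
      ≡⟨ cong₂ (λ G q → tur (suc r) k G + q * tur⁻ (suc r) k G + tur⁻ (suc r) k G) n≡ (/-rem (suc r) q ρ (m≤n⇒m≤1+n ρ≤r)) ⟩
    tur (suc r) k H + q * tur⁻ (suc r) k H + tur⁻ (suc r) k H  ≡⟨ +-suc-* (tur (suc r) k H) q _ ⟩
    tur (suc r) k H + suc q * tur⁻ (suc r) k H          ∎
    where open ≡-Reasoning

-- The bounds on `y` pin down the top vertex, so any witness of this size opens up at `b`.
Sh-at : ∀ {r k u s} b y → u ≡ tur (suc r) (suc k) b + y → 1 ≤ y → y ≤ tur r k (nbrs r b) →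
  Sh (suc r) (suc k) u s → ∃[ t ] Sh r k y t × tur (suc r) k b + t ≤ s
Sh-at {r} {k} b y u≡ 1≤y y≤ none = ⊥-elim (<⇒≱ 1≤y (≤-trans (m≤n+m y _) (≤-reflexive (sym u≡))))
Sh-at {r} {k} b y u≡ 1≤y y≤ (step b₀ y₀ t refl 1≤y₀ y₀≤ Y le)
  with ≤-antisym {b} {b₀}
    (block-index r k {b} {b₀} y₀≤ (≤-trans (≤-reflexive (+-comm 1 _)) (≤-trans (+-monoʳ-≤ _ 1≤y) (≤-reflexive (sym u≡)))))
    (block-index r k {b₀} {b} y≤ (≤-trans (≤-reflexive (+-comm 1 _)) (≤-trans (+-monoʳ-≤ _ 1≤y₀) (≤-reflexive u≡))))
... | refl with +-cancelˡ-≡ (tur (suc r) (suc k) b) y₀ y u≡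
... | refl = t , Y , le

module ConeStep (r k : ℕ) (cone : Cone r k) where

  private
    U V W B : ℕ → ℕ
    W = tur (suc r) (suc (suc k))
    U = tur (suc r) (suc k)
    V = tur (suc r) k
    B h = tur r k (nbrs r h)

    -- At most `n` entries exceeding `U h` are selected: `m` is their number, `zs` holds their
    -- excesses over `U h`, and `rest` all other entries. If fewer than `n` are found, no entry of
    -- `rest` exceeds `U h`.
    record Picked (h z n : ℕ) (p : ℕ) (ys : List (ℕ × ℕ)) : Set where
      field
        m        : ℕ
        zs rest  : List (ℕ × ℕ)
        links    : All (Link r k z) zs
        others   : All (Link (suc r) (suc k) p) rest
        sum₁     : Σ₁ ys ≡ m * U h + Σ₁ zs + Σ₁ rest
        sum₂     : m * V h + Σ₂ zs + Σ₂ rest ≤ Σ₂ ys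
        Σzs≤     : Σ₁ zs ≤ m * B h
        complete : m ≡ n ⊎ (m < n × All (Link (suc r) (suc k) (U h)) rest)

    pick : ∀ h z n ys → z ≤ B h → All (Link (suc r) (suc k) (U h + z)) ys → Picked h z n (U h + z) ys
    pick h z zero ys z≤ as = record
      { m = 0 ; zs = [] ; rest = ys ; links = [] ; others = as ; sum₁ = refl ; sum₂ = ≤-refl
      ; Σzs≤ = z≤n ; complete = inj₁ refl }
    pick h z (suc n) [] z≤ [] = record
      { m = 0 ; zs = [] ; rest = [] ; links = [] ; others = [] ; sum₁ = refl ; sum₂ = z≤n
      ; Σzs≤ = z≤n ; complete = inj₂ (s≤s z≤n , []) }
    pick h z (suc n) ((y , s) ∷ ys) z≤ ((y≤ , Y) ∷ as) with ≤-<-connex y (U h)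
    ... | inj₁ y≤U = record
      { m = m ; zs = zs ; rest = (y , s) ∷ rest ; links = links ; others = (y≤ , Y) ∷ others
      ; sum₁ = trans (cong (y +_) sum₁) (reorder y (m * U h) (Σ₁ zs) (Σ₁ rest))
      ; sum₂ = ≤-trans (≤-reflexive (sym (reorder s (m * V h) (Σ₂ zs) (Σ₂ rest)))) (+-monoʳ-≤ s sum₂)
      ; Σzs≤ = Σzs≤
      ; complete = [ inj₁ , (λ (lt , al) → inj₂ (lt , (y≤U , Y) ∷ al)) ]′ complete }
      where
      open Picked (pick h z (suc n) ys z≤ as)
      reorder : ∀ y a b c → y + (a + b + c) ≡ a + b + (y + c)
      reorder = solve-∀
    ... | inj₂ U<y with Sh-at h (y ∸ U h) (sym (m+[n∸m]≡n (<⇒≤ U<y))) (m<n⇒0<n∸m U<y)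
                         (≤-trans (m≤n+o⇒m∸n≤o y (U h) y≤) z≤) Y
    ... | t , Y′ , le = record
      { m = suc m ; zs = (y ∸ U h , t) ∷ zs ; rest = rest
      ; links = (m≤n+o⇒m∸n≤o y (U h) y≤ , Y′) ∷ links ; others = others
      ; sum₁ = trans (cong₂ _+_ (sym (m+[n∸m]≡n (<⇒≤ U<y))) sum₁)
                 (reorder (U h) (y ∸ U h) (m * U h) (Σ₁ zs) (Σ₁ rest))
      ; sum₂ = ≤-trans (≤-reflexive (sym (reorder (V h) t (m * V h) (Σ₂ zs) (Σ₂ rest)))) (+-mono-≤ le sum₂)
      ; Σzs≤ = +-mono-≤ (≤-trans (m≤n+o⇒m∸n≤o y (U h) y≤) z≤) Σzs≤
      ; complete = [ (λ e → inj₁ (cong suc e)) , (λ (lt , al) → inj₂ (s≤s lt , al)) ]′ complete }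
      where
      open Picked (pick h z n ys z≤ as)
      reorder : ∀ u z a b c → u + z + (a + b + c) ≡ u + a + (z + b) + c
      reorder = solve-∀

    -- If `e` exceeds `W h`, its top vertex is `h`: a later one would force a shadow above
    -- `U (suc h)`, hence above `p`.
    base-split : ∀ h {e p} → p ≤ U (suc h) → U h ≤ p → Sh (suc r) (suc (suc k)) e p →
      ∃[ f ] e ≤ W h + f × Sh r (suc k) f (p ∸ U h) × f ≤ tur r (suc k) (nbrs r h)
    base-split h {e} {p} p≤ U≤p E with ≤-<-connex e (W h)
    ... | inj₁ e≤ = 0 , ≤-trans e≤ (m≤m+n _ 0) , none , z≤n
    base-split h {e} {p} p≤ U≤p (step b₀ y s refl 1≤y y≤ Y le) | inj₂ W<e with
      ≤-antisym {h} {b₀} (block-index r (suc k) {h} {b₀} y≤ W<e)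
        (≮⇒≥ λ h<b₀ → <⇒≱ (≤-trans (≤-reflexive (+-comm 1 (U b₀))) (≤-trans (+-monoʳ-≤ (U b₀) (Sh-pos Y 1≤y)) le))
                        (≤-trans p≤ (tur-mono (suc r) (suc k) h<b₀)))
    ... | refl = y , ≤-refl , Sh-mono (m+n≤o⇒m≤o∸n s (≤-trans (≤-reflexive (+-comm s (U h))) le)) Y , y≤

    add-all : ∀ b {p u s} → p ≤ tur (suc r) (suc k) (nbrs (suc r) b) → ∀ ys → All (Link (suc r) (suc k) p) ys →
      tur (suc (suc r)) (suc (suc k)) b ≤ u → tur (suc (suc r)) (suc k) b ≤ s →
      Sh (suc (suc r)) (suc (suc k)) u s → Sh (suc (suc r)) (suc (suc k)) (u + Σ₁ ys) (s + Σ₂ ys)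
    add-all b p≤ [] [] u≥ s≥ S = subst₂ (Sh _ _) (sym (+-identityʳ _)) (sym (+-identityʳ _)) S
    add-all b {u = u} {s} p≤ ((y , t) ∷ ys) ((y≤ , Y) ∷ as) u≥ s≥ S =
      subst₂ (Sh _ _) (+-assoc u y (Σ₁ ys)) (+-assoc s t (Σ₂ ys))
        (add-all b p≤ ys as (≤-trans u≥ (m≤m+n _ _)) (≤-trans s≥ (m≤m+n _ _))
          (Sum.Sh-add (suc r) (suc k) b u≥ s≥ S (≤-trans y≤ p≤) Y))

  -- Split at the largest full Turán graph U h below p. The parts of the y's above U h form a cone
  -- with one part less, of size X. If more than h / (r+1) of the y's exceed U h, everything else can
  -- be added to a full Turán graph; otherwise X ≤ U h and p decreases to U h.
  cone-suc : Cone (suc r) (suc k)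
  cone-suc zero ys z≤n E as = cone-empty ys E as
  cone-suc (suc h) {p} {e} ys p≤ E as with ≤-<-connex p (U h)
  ... | inj₁ p≤U = cone-suc h ys p≤U E as
  ... | inj₂ U<p = [ many , few ]′ complete
    where
    q z : ℕ
    q = h / suc r
    z = p ∸ U h
    p≡ : U h + z ≡ p
    p≡ = m+[n∸m]≡n (<⇒≤ U<p)
    z≤ : z ≤ B h
    z≤ = m≤n+o⇒m∸n≤o p (U h) p≤
    open Picked (pick h z (suc q) ys z≤ (subst (λ p → All (Link (suc r) (suc k) p) ys) (sym p≡) as))
    f : ℕ
    f = proj₁ (base-split h p≤ (<⇒≤ U<p) E)
    e≤ : e ≤ W h + f
    e≤ = proj₁ (proj₂ (base-split h p≤ (<⇒≤ U<p) E))
    f≤ : f ≤ tur r (suc k) (nbrs r h)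
    f≤ = proj₂ (proj₂ (proj₂ (base-split h p≤ (<⇒≤ U<p) E)))
    X : ℕ
    X = f + Σ₁ zs
    SX : Sh (suc r) (suc k) X (z + Σ₂ zs)
    SX = cone (nbrs r h) zs z≤ (proj₁ (proj₂ (proj₂ (base-split h p≤ (<⇒≤ U<p) E)))) links
    X≤ : X ≤ tur r (suc k) (nbrs r h) + m * B h
    X≤ = +-mono-≤ f≤ Σzs≤
    u≤ : ∀ {u} → W h + m * U h + X + Σ₁ rest ≡ u → e + Σ₁ ys ≤ u
    u≤ refl = ≤-trans (+-mono-≤ e≤ (≤-reflexive sum₁))
      (≤-reflexive (lemma (W h) f (m * U h) (Σ₁ zs) (Σ₁ rest)))
      where
      lemma : ∀ w f a b c → w + f + (a + b + c) ≡ w + a + (f + b) + c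
      lemma = solve-∀
    s≤ : ∀ {s} → U h + m * V h + (z + Σ₂ zs) + Σ₂ rest ≡ s → s ≤ p + Σ₂ ys
    s≤ refl = ≤-trans (≤-reflexive (lemma (U h) (m * V h) z (Σ₂ zs) (Σ₂ rest)))
      (+-mono-≤ (≤-reflexive p≡) sum₂)
      where
      lemma : ∀ u a z b c → u + a + (z + b) + c ≡ u + z + (a + b + c)
      lemma = solve-∀
    many : m ≡ suc q → Sh (suc (suc r)) (suc (suc k)) (e + Σ₁ ys) (p + Σ₂ ys)
    many m≡ = Sh-down (Sh-mono (s≤ (cong (λ s → s + (z + Σ₂ zs) + Σ₂ rest) (trans (cong (λ m → U h + m * V h) m≡) (sym star₁))))
        (add-all b⁺ p≤⁺ rest (subst (λ p → All (Link (suc r) (suc k) p) rest) p≡ others) (m≤m+n _ _) (m≤m+n _ _)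
          (Sum.Sh-add (suc r) (suc k) b⁺ ≤-refl ≤-refl (Sh-full (suc (suc r)) (suc (suc k)) b⁺ ≤-refl) X≤⁺ SX)))
      (u≤ (cong (λ s → s + X + Σ₁ rest) (trans (cong (λ m → W h + m * U h) m≡) (sym star₂))))
      where
      -- By `tur-star`, the full graph on `h` vertices and `suc q` points joined to all of it count
      -- like the Turán graph on `b⁺` vertices with one more part. Its next vertex has `suc h`
      -- earlier neighbours, which leaves room for `X` and for every link of size at most `p`.
      b⁺ = suc (h + q)
      star₁ : tur (suc (suc r)) (suc k) b⁺ ≡ U h + suc q * V h
      star₁ = proj₁ (tur-star r (suc k) h)
      star₂ : tur (suc (suc r)) (suc (suc k)) b⁺ ≡ W h + suc q * U h
      star₂ = proj₁ (tur-star r (suc (suc k)) h)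
      n≡ : U (suc h) ≡ tur (suc r) (suc k) (nbrs (suc r) b⁺)
      n≡ = cong U (sym (proj₂ (tur-star r (suc k) h)))
      p≤⁺ : p ≤ tur (suc r) (suc k) (nbrs (suc r) b⁺)
      p≤⁺ = ≤-trans p≤ (≤-reflexive n≡)
      X≤⁺ : X ≤ tur (suc r) (suc k) (nbrs (suc r) b⁺)
      X≤⁺ = begin
        X                                               ≤⟨ X≤ ⟩
        tur r (suc k) (nbrs r h) + m * B h              ≡⟨ cong (λ m → tur r (suc k) (nbrs r h) + m * B h) m≡ ⟩
        tur r (suc k) (nbrs r h) + suc q * B h          ≡⟨ sym (+-suc-* (tur r (suc k) (nbrs r h)) q (B h)) ⟩
        tur r (suc k) (nbrs r h) + q * B h + B h        ≡⟨ cong (_+ B h) (sym (tur-slice r (suc k) h)) ⟩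
        U (suc h)                                       ≡⟨ n≡ ⟩
        tur (suc r) (suc k) (nbrs (suc r) b⁺)           ∎
        where open ≤-Reasoning
    -- The new cone over `U h` has one vertex with link `X`, `m` vertices with full links, and those
    -- in `rest`. From `m ≤ q` and `tur-slice` follows `X ≤ U h`.
    few : m < suc q × All (Link (suc r) (suc k) (U h)) rest → Sh (suc (suc r)) (suc (suc k)) (e + Σ₁ ys) (p + Σ₂ ys)
    few (s≤s m≤q , low) = Sh-down (Sh-mono (s≤ (trans (lemma (U h) (m * V h) (z + Σ₂ zs) (Σ₂ rest))
          (cong (λ x → U h + (z + Σ₂ zs + x)) (sym (Σ₂-replicate m (U h) (V h) rest)))))
        (cone-suc h ((X , z + Σ₂ zs) ∷ replicate m (U h , V h) ++ rest) ≤-refl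
          (Sh-full (suc r) (suc (suc k)) h ≤-refl)
          ((X≤U , SX) ∷ All.++⁺ (All.replicate⁺ m (≤-refl , Sh-full (suc r) (suc k) h ≤-refl)) low)))
      (u≤ (trans (lemma (W h) (m * U h) X (Σ₁ rest))
        (cong (λ x → W h + (X + x)) (sym (Σ₁-replicate m (U h) (V h) rest)))))
      where
      lemma : ∀ w a x c → w + a + x + c ≡ w + (x + (a + c))
      lemma = solve-∀
      X≤U : X ≤ U h
      X≤U = ≤-trans X≤ (≤-trans (+-monoʳ-≤ _ (*-monoˡ-≤ (B h) m≤q)) (≤-reflexive (sym (tur-slice r (suc k) h))))

-- For `k = 0` the shadow of any nonempty vertex set is the one empty clique; with no parts and
-- positive `k`, `p` is 0.
cone : ∀ r k → Cone r k
cone r zero h {zero} ys p≤ E as = cone-empty ys E as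
cone r zero h {suc p} {e} ys p≤ E as = Sh-mono (s≤s z≤n)
  (Sh-full (suc r) 1 (e + Σ₁ ys) (≤-reflexive (sym (tur-vertices r _))))
cone zero (suc k) h ys z≤n E as = cone-empty ys E as
cone (suc r) (suc k) = ConeStep.cone-suc r k (cone r k)

-- Cascades

sum0-head : ∀ s f → sum0 (suc s) f ≡ f 0 + sum0 s (f ∘ suc)
sum0-head zero    f = refl
sum0-head (suc s) f = trans (cong (_+ f (suc (suc s))) (sum0-head s f)) (+-assoc (f 0) _ _)

head≤sum0 : ∀ s f → f 0 ≤ sum0 s f
head≤sum0 zero    f = ≤-refl
head≤sum0 (suc s) f = ≤-trans (head≤sum0 s f) (m≤m+n _ _)

cascade : ℕ → ℕ → (ℕ → ℕ) → ℕ → ℕ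
cascade r k b s = sum0 s (λ j → tur (r ∸ j) (k ∸ j) (b j))

Descending : ℕ → (ℕ → ℕ) → ℕ → Set
Descending r b s = ∀ j → j < s → b (suc j) < b j ∸ (b j div (r ∸ j))

Descending-tail : ∀ {r b s} → Descending (suc r) b (suc s) → Descending r (b ∘ suc) s
Descending-tail desc j j<s = desc (suc j) (s≤s j<s)

-- `Descending` puts the next entry below the number of earlier neighbours of `b 0`, so inductively
-- the tail fits into the block of `b 0`.
cascade≤ : ∀ s r k b → s < r → s < k → Descending r b s → cascade r k b s ≤ tur r k (suc (b 0))
cascade≤ zero r k b _ _ _ = tur-mono r k (n≤1+n _)
cascade≤ (suc s) (suc r) (suc k) b (s≤s s<r) (s≤s s<k) desc = begin
  cascade (suc r) (suc k) b (suc s)                       ≡⟨ sum0-head s _ ⟩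
  tur (suc r) (suc k) (b 0) + cascade r k (b ∘ suc) s     ≤⟨ +-monoʳ-≤ _ (cascade≤ s r k (b ∘ suc) s<r s<k (Descending-tail desc)) ⟩
  tur (suc r) (suc k) (b 0) + tur r k (suc (b 1))         ≤⟨ +-monoʳ-≤ _ (tur-mono r k (desc 0 (s≤s z≤n))) ⟩
  tur (suc r) (suc k) (suc (b 0))                         ∎
  where open ≤-Reasoning

-- Compares the top vertex `β` with `b 0`: a smaller one gives the claim at once, a larger one makes
-- the shadow too big, and equality reduces to the tails.
cascade-shadow : ∀ s r k b {u m} → s < r → s < k → Descending r b s →
  Sh r (suc k) u m → m ≤ cascade r k b s → u ≤ cascade r (suc k) b s
cascade-shadow s r k b s<r s<k desc none m≤ = z≤n
cascade-shadow s (suc r) (suc k) b {m = m} s<r s<k desc (step β y t refl 1≤y y≤ Y le) m≤ with <-cmp β (b 0)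
... | tri< β<b₀ _ _ = ≤-trans (+-monoʳ-≤ _ y≤) (≤-trans (tur-mono (suc r) (suc (suc k)) β<b₀) (head≤sum0 s _))
... | tri> _ _ b₀<β = ⊥-elim (<⇒≱ (begin-strict
  m                                 ≤⟨ m≤ ⟩
  cascade (suc r) (suc k) b s       ≤⟨ cascade≤ s (suc r) (suc k) b s<r s<k desc ⟩
  tur (suc r) (suc k) (suc (b 0))   ≤⟨ tur-mono (suc r) (suc k) b₀<β ⟩
  tur (suc r) (suc k) β             <⟨ m<m+n _ (Sh-pos Y 1≤y) ⟩
  tur (suc r) (suc k) β + t         ∎) le)
  where open ≤-Reasoning
-- With no tail left, the nonempty top block pushes the shadow past the only term.
cascade-shadow zero (suc r) (suc k) b s<r s<k desc (step β y t refl 1≤y y≤ Y le) m≤ | tri≈ _ refl _ =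
  ⊥-elim (<⇒≱ (m<m+n _ (Sh-pos Y 1≤y)) (≤-trans le m≤))
cascade-shadow (suc s) (suc r) (suc k) b (s≤s s<r) (s≤s s<k) desc (step β y t refl 1≤y y≤ Y le) m≤ | tri≈ _ refl _ =
  ≤-trans (+-monoʳ-≤ _ (cascade-shadow s r k (b ∘ suc) s<r s<k (Descending-tail desc) Y
      (+-cancelˡ-≤ (tur (suc r) (suc k) (b 0)) t _ (≤-trans le (≤-trans m≤ (≤-reflexive (sum0-head s _)))))))
    (≤-reflexive (sym (sum0-head s _)))

-- Cliques in lists of vertices

argmax : {A : Set} (f : A → ℕ) (x : A) (l : List A) → ∃[ v ] v ∈ x ∷ l × All (λ w → f w ≤ f v) (x ∷ l)
argmax f x [] = x , here refl , ≤-refl ∷ []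
argmax f x (y ∷ l) with argmax f y l
... | v , v∈ , al with ≤-total (f x) (f v)
... | inj₁ x≤v = v , there v∈ , x≤v ∷ al
... | inj₂ v≤x = x , here refl , ≤-refl ∷ All.map (λ w≤v → ≤-trans w≤v v≤x) al

filter-swap : {A : Set} (p q : A → Bool) (l : List A) → filterᵇ p (filterᵇ q l) ≡ filterᵇ q (filterᵇ p l)
filter-swap p q [] = refl
filter-swap p q (x ∷ l) with p x in px | q x in qx
... | true  | true  rewrite px | qx = cong (x ∷_) (filter-swap p q l)
... | true  | false rewrite qx = filter-swap p q l
... | false | true  rewrite px = filter-swap p q l
... | false | false = filter-swap p q l

filter-split : {A : Set} (p : A → Bool) (l : List A) → l ↭ filterᵇ (not ∘ p) l ++ filterᵇ p l
filter-split p [] = refl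
filter-split p (x ∷ l) with p x
... | true  = ↭-trans (prep x (filter-split p l)) (↭-sym (shift x (filterᵇ (not ∘ p) l) (filterᵇ p l)))
... | false = prep x (filter-split p l)

filterᵇ-⊆ : {A : Set} (p : A → Bool) {l l′ : List A} → l ⊆ l′ → filterᵇ p l ⊆ filterᵇ p l′
filterᵇ-⊆ p = filter⁺ (T? ∘ p) (T? ∘ p) (λ { refl t → t })

⊆-++ˡ : {A : Set} (xs : List A) {ys : List A} → ys ⊆ xs ++ ys
⊆-++ˡ []       = ⊆-refl
⊆-++ˡ (x ∷ xs) = x ∷ʳ ⊆-++ˡ xs

module Cliques {A : Set} (adj : A → A → Bool) where

  -- Each clique is counted at its first vertex in the list, so links are filtered lists.
  cc : ℕ → List A → ℕ
  cc zero    l       = 1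
  cc (suc k) []      = 0
  cc (suc k) (v ∷ l) = cc (suc k) l + cc k (filterᵇ (adj v) l)

  cc-⊆ : ∀ k {l l′} → l ⊆ l′ → cc k l ≤ cc k l′
  cc-⊆ zero    l⊆l′       = ≤-refl
  cc-⊆ (suc k) []         = ≤-refl
  cc-⊆ (suc k) (y ∷ʳ l⊆l′) = ≤-trans (cc-⊆ (suc k) l⊆l′) (m≤m+n _ _)
  cc-⊆ (suc k) (_∷_ {x = v} refl l⊆l′) =
    +-mono-≤ (cc-⊆ (suc k) l⊆l′) (cc-⊆ k (filterᵇ-⊆ (adj v) l⊆l′))

  cc-length : ∀ k l → length l < k → cc k l ≡ 0
  cc-length (suc k) []      _         = refl
  cc-length (suc k) (v ∷ l) (s≤s l<k) = cong₂ _+_ (cc-length (suc k) l (m≤n⇒m≤1+n l<k))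
    (n≤0⇒n≡0 (≤-trans (cc-⊆ k (filter-⊆ (T? ∘ adj v) l)) (≤-reflexive (cc-length k l l<k))))

  -- The number of j-cliques of O ++ K that are not contained in K (for j ≥ 1).
  beyond : List A → ℕ → List A → ℕ
  beyond K zero    O       = 0
  beyond K (suc j) []      = 0
  beyond K (suc j) (w ∷ O) = cc j (filterᵇ (adj w) (O ++ K)) + beyond K (suc j) O

  cc-++ : ∀ K j O → cc (suc j) (O ++ K) ≡ cc (suc j) K + beyond K (suc j) O
  cc-++ K j []      = sym (+-identityʳ _)
  cc-++ K j (w ∷ O) = trans (cong (_+ cc j (filterᵇ (adj w) (O ++ K))) (cc-++ K j O))
    (+-rotate (cc (suc j) K) (beyond K (suc j) O) _)

  -- With `p = adj w` this bounds the link of `w` by its part in `K` plus the cliques already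
  -- present outside `K`.
  cc-filter-++ : ∀ (p : A → Bool) K j O →
    cc (suc j) (filterᵇ p (O ++ K)) ≤ cc (suc j) (filterᵇ p K) + beyond K (suc j) O
  cc-filter-++ p K j [] = m≤m+n _ _
  cc-filter-++ p K j (w ∷ O) with p w
  ... | true  = ≤-trans (+-mono-≤ (cc-filter-++ p K j O) (cc-⊆ j (filterᵇ-⊆ (adj w) (filter-⊆ (T? ∘ p) (O ++ K)))))
    (≤-reflexive (+-rotate (cc (suc j) (filterᵇ p K)) (beyond K (suc j) O) _))
  ... | false = ≤-trans (cc-filter-++ p K j O) (+-monoʳ-≤ (cc (suc j) (filterᵇ p K)) (m≤n+m _ _))

  IsCliqueList : List A → Set
  IsCliqueList = AllPairs (λ u v → adj u v ≡ true)

  cc-clique : ∀ k {l} → IsCliqueList l → cc k l ≡ length l C k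
  cc-clique zero    cl        = refl
  cc-clique (suc k) []        = refl
  cc-clique (suc k) {v ∷ l} (vl ∷ cl) = begin
    cc (suc k) l + cc k (filterᵇ (adj v) l)  ≡⟨ cong (λ l′ → cc (suc k) l + cc k l′) (filter-all (T? ∘ adj v) (All.map (Equivalence.from T-≡) vl)) ⟩
    cc (suc k) l + cc k l                    ≡⟨ cong₂ _+_ (cc-clique (suc k) cl) (cc-clique k cl) ⟩
    length l C suc k + length l C k          ≡⟨ +-comm (length l C suc k) _ ⟩
    length l C k + length l C suc k          ≡⟨ nCk+nC[k+1]≡[n+1]C[k+1] (length l) k ⟩
    suc (length l) C suc k                   ∎
    where open ≡-Reasoning

  HasClique : ℕ → List A → Set
  HasClique n l = ∃[ K ] ∃[ O ] l ↭ O ++ K × length K ≡ n × IsCliqueList K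

  private
    HasClique-∷ : ∀ {n v l} → HasClique n l → HasClique n (v ∷ l)
    HasClique-∷ {v = v} (K , O , l↭ , len , cl) = K , v ∷ O , prep v l↭ , len , cl

    HasClique-cone : ∀ {n v l} → HasClique n (filterᵇ (adj v) l) → HasClique (suc n) (v ∷ l)
    HasClique-cone {v = v} {l} (K , O , l↭ , len , cl) = v ∷ K , N ++ O ,
      ↭-trans (prep v (↭-trans (filter-split (adj v) l) (↭-trans (++⁺ˡ N l↭) (↭-sym (++-assoc N O K)))))
        (↭-sym (shift v (N ++ O) K)) ,
      cong suc len ,
      All.++⁻ʳ O (All-resp-↭ l↭ (All.map (Equivalence.to T-≡) (All.all-filter (T? ∘ adj v) l))) ∷ cl
      where
      N = filterᵇ (not ∘ adj v) l

    pos-+ : ∀ a {b} → 1 ≤ a + b → 1 ≤ a ⊎ 1 ≤ b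
    pos-+ zero    p = inj₂ p
    pos-+ (suc a) p = inj₁ (s≤s z≤n)

  find-clique : ∀ n l → 1 ≤ cc n l → HasClique n l
  find-clique zero    l       _ = [] , l , ↭-sym (++-comm l []) , refl , []
  find-clique (suc n) (v ∷ l) p = [
    (λ q → HasClique-∷ (find-clique (suc n) l q)) ,
    (λ q → HasClique-cone (find-clique n (filterᵇ (adj v) l) q)) ]′ (pos-+ (cc (suc n) l) p)

  module _ (adj-sym : ∀ u v → adj u v ≡ adj v u) where

    private
      cc-swap : ∀ k x y l → cc (suc k) (x ∷ y ∷ l) ≡ cc (suc k) (y ∷ x ∷ l)
      cc-swap k x y l rewrite adj-sym y x with adj x y
      ... | false = lemma (cc (suc k) l) (cc k (filterᵇ (adj y) l)) (cc k (filterᵇ (adj x) l))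
        where
        lemma : ∀ a b c → a + b + c ≡ a + c + b
        lemma = solve-∀
      cc-swap zero    x y l | true = refl
      cc-swap (suc k) x y l | true rewrite filter-swap (adj x) (adj y) l =
        lemma (cc (suc (suc k)) l) (cc (suc k) (filterᵇ (adj y) l)) (cc (suc k) (filterᵇ (adj x) l)) _
        where
        lemma : ∀ a b c d → a + b + (c + d) ≡ a + c + (b + d)
        lemma = solve-∀

    -- The recursion follows list order; by symmetry of `adj`, swapping two neighbouring entries
    -- counts the cliques through both of them alike.
    cc-↭ : ∀ k {l l′} → l ↭ l′ → cc k l ≡ cc k l′
    cc-↭ zero    p             = refl
    cc-↭ (suc k) refl          = refl
    cc-↭ (suc k) (prep x p)    = cong₂ _+_ (cc-↭ (suc k) p) (cc-↭ k (filter-↭ (T? ∘ adj x) p))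
    cc-↭ (suc k) (↭-step p q)  = trans (cc-↭ (suc k) p) (cc-↭ (suc k) q)
    cc-↭ (suc k) (swap {xs = l} x y p) = trans (cc-swap k x y l)
      (cong₂ _+_ (cong₂ _+_ (cc-↭ (suc k) p) (cc-↭ k (filter-↭ (T? ∘ adj x) p)))
        (cc-↭ k (filter-↭ (T? ∘ adj y) (prep x p))))

    module _ (adj-irrefl : ∀ v → adj v v ≡ false) where

      -- Moving `w` to the front turns the cliques of its link into cliques through `w`;
      -- irreflexivity keeps `w` out of its own link.
      cc-link : ∀ k l → All (λ w → cc k (filterᵇ (adj w) l) ≤ cc (suc k) l) l
      cc-link k l = All.tabulate link
        where
        link : ∀ {w} → w ∈ l → cc k (filterᵇ (adj w) l) ≤ cc (suc k) l
        link {w} w∈l with ∈-∃++ w∈l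
        ... | xs , ys , refl = begin
          cc k (filterᵇ (adj w) l)                  ≡⟨ cc-↭ k (filter-↭ (T? ∘ adj w) l↭) ⟩
          cc k (filterᵇ (adj w) (w ∷ xs ++ ys))     ≡⟨ cong (cc k) w∉ ⟩
          cc k (filterᵇ (adj w) (xs ++ ys))         ≤⟨ m≤n+m _ _ ⟩
          cc (suc k) (w ∷ xs ++ ys)                 ≡⟨ sym (cc-↭ (suc k) l↭) ⟩
          cc (suc k) l                              ∎
          where
          open ≤-Reasoning
          l↭ : l ↭ w ∷ xs ++ ys
          l↭ = shift w xs ys
          w∉ : filterᵇ (adj w) (w ∷ xs ++ ys) ≡ filterᵇ (adj w) (xs ++ ys)
          w∉ rewrite adj-irrefl w = refl

      -- Each vertex of `O` is recorded by the clique counts of its link among later vertices.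
      -- `Cone` sees only these sizes and shadows, so edges inside `O` do no harm.
      pieces : ℕ → List A → List A → List (ℕ × ℕ)
      pieces k []      K = []
      pieces k (w ∷ O) K = (cc (suc k) (filterᵇ (adj w) (O ++ K)) , cc k (filterᵇ (adj w) (O ++ K))) ∷ pieces k O K

      Σ₁-pieces : ∀ k O K → Σ₁ (pieces k O K) ≡ beyond K (suc (suc k)) O
      Σ₁-pieces k []      K = refl
      Σ₁-pieces k (w ∷ O) K = cong (cc (suc k) (filterᵇ (adj w) (O ++ K)) +_) (Σ₁-pieces k O K)

      Σ₂-pieces : ∀ k O K → Σ₂ (pieces k O K) ≡ beyond K (suc k) O
      Σ₂-pieces k []      K = refl
      Σ₂-pieces k (w ∷ O) K = cong (cc k (filterᵇ (adj w) (O ++ K)) +_) (Σ₂-pieces k O K)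

      -- Passing to a link lowers the forbidden clique size by one, so induction covers the link `N`
      -- of `v` and all links in `pieces`; the maximal choice of `v` gives the cap `p` that `Cone`
      -- requires.
      clique-shadow : ∀ r k l → cc (suc r) l ≡ 0 → Sh r (suc k) (cc (suc k) l) (cc k l)
      clique-shadow zero    k []      _ = none
      clique-shadow zero    k (v ∷ l) free = ⊥-elim (<⇒≢ (≤-trans (s≤s z≤n) (m≤n+m 1 (cc 1 l))) (sym free))
      clique-shadow (suc r) k []      _ = none
      clique-shadow (suc r) zero l@(_ ∷ _) _ = Sh-full (suc r) 1 (cc 1 l) (≤-reflexive (sym (tur-vertices r _)))
      clique-shadow (suc r) (suc k) l@(x ∷ l₀) free = subst₂ (Sh (suc r) (suc (suc k))) u≡ s≡
        (cone r (suc k) (proj₁ bound) (pieces k B N) (proj₂ bound)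
          (clique-shadow r (suc k) N N-free) (links B ⊆-refl (All.filter⁺ (T? ∘ not ∘ adj v) small)))
        where
        v = proj₁ (argmax (λ w → cc (suc k) (filterᵇ (adj w) l)) x l₀)
        N B : List A
        N = filterᵇ (adj v) l
        B = filterᵇ (not ∘ adj v) l
        p = cc (suc k) N
        l↭ : l ↭ B ++ N
        l↭ = filter-split (adj v) l
        link-free : ∀ w → cc (suc r) (filterᵇ (adj w) l) ≤ cc (suc (suc r)) l → cc (suc r) (filterᵇ (adj w) l) ≡ 0
        link-free w le = n≤0⇒n≡0 (≤-trans le (≤-reflexive free))
        small : All (λ w → cc (suc k) (filterᵇ (adj w) (B ++ N)) ≤ p × cc (suc r) (filterᵇ (adj w) (B ++ N)) ≡ 0) l
        small = All.map
          (λ {w} (le , le′) → ≤-trans (≤-reflexive (cc-↭ (suc k) (filter-↭ (T? ∘ adj w) (↭-sym l↭)))) le ,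
                              trans (cc-↭ (suc r) (filter-↭ (T? ∘ adj w) (↭-sym l↭))) (link-free w le′))
          (All.zip (proj₂ (proj₂ (argmax (λ w → cc (suc k) (filterᵇ (adj w) l)) x l₀)) , cc-link (suc r) l))
        N-free : cc (suc r) N ≡ 0
        N-free = link-free v (All.lookup (cc-link (suc r) l) (proj₁ (proj₂ (argmax (λ w → cc (suc k) (filterᵇ (adj w) l)) x l₀))))
        -- `Cone` needs a full graph with at least `p` cliques; `Sh` guarantees one, since it
        -- asserts that the segment exists.
        bound : ∃[ h ] p ≤ tur r (suc k) h
        bound = Sh-bound (clique-shadow r k N N-free)
        links : ∀ O → O ++ N ⊆ B ++ N →
          All (λ w → cc (suc k) (filterᵇ (adj w) (B ++ N)) ≤ p × cc (suc r) (filterᵇ (adj w) (B ++ N)) ≡ 0) O →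
          All (Link r (suc k) p) (pieces k O N)
        links []      sub []               = []
        links (w ∷ O) sub ((le , fr) ∷ as) =
          (≤-trans (cc-⊆ (suc k) sub′) le ,
           clique-shadow r k _ (n≤0⇒n≡0 (≤-trans (cc-⊆ (suc r) sub′) (≤-reflexive fr)))) ∷
          links O sub″ as
          where
          sub″ : O ++ N ⊆ B ++ N
          sub″ = ⊆-trans (w ∷ʳ ⊆-refl) sub
          sub′ : filterᵇ (adj w) (O ++ N) ⊆ filterᵇ (adj w) (B ++ N)
          sub′ = filterᵇ-⊆ (adj w) sub″
        u≡ : cc (suc (suc k)) N + Σ₁ (pieces k B N) ≡ cc (suc (suc k)) l
        u≡ = trans (cong (cc (suc (suc k)) N +_) (Σ₁-pieces k B N))
          (sym (trans (cc-↭ (suc (suc k)) l↭) (cc-++ N (suc k) B)))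
        s≡ : p + Σ₂ (pieces k B N) ≡ cc (suc k) l
        s≡ = trans (cong (p +_) (Σ₂-pieces k B N)) (sym (trans (cc-↭ (suc k) l↭) (cc-++ N k B)))

-- Graphs containing a large clique

-- With no more vertices than parts, the Turán graph is complete.
tur-C : ∀ r k b → b ≤ r → tur r k b ≡ b C k
tur-C r       zero    b       b≤r = refl
tur-C zero    (suc k) zero    b≤r = refl
tur-C (suc r) (suc k) zero    b≤r = refl
tur-C (suc r) (suc k) (suc b) (s≤s b≤r) = begin
  tur (suc r) (suc k) b + tur r k (nbrs r b)  ≡⟨ cong (λ q → tur (suc r) (suc k) b + tur r k (b ∸ q)) (m<n⇒m/n≡0 (s≤s b≤r)) ⟩
  tur (suc r) (suc k) b + tur r k b           ≡⟨ cong₂ _+_ (tur-C (suc r) (suc k) b (m≤n⇒m≤1+n b≤r)) (tur-C r k b b≤r) ⟩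
  b C suc k + b C k                           ≡⟨ +-comm (b C suc k) _ ⟩
  b C k + b C suc k                           ≡⟨ nCk+nC[k+1]≡[n+1]C[k+1] b k ⟩
  suc b C suc k                               ∎
  where open ≡-Reasoning

C-mono : ∀ k {m n} → m ≤ n → m C k ≤ n C k
C-mono k {m} {n} m≤n = subst₂ _≤_ (tur-C n k m m≤n) (tur-C n k n ≤-refl) (tur-mono n k m≤n)

tur-shadow : ∀ {r k u m} n → Sh (suc r) (suc (suc k)) u m → m ≤ tur (suc r) (suc k) n → u ≤ tur (suc r) (suc (suc k)) n
tur-shadow {r} {k} n = cascade-shadow 0 (suc r) (suc k) (λ _ → n) (s≤s z≤n) (s≤s z≤n) (λ _ ())

-- State r j n M U: a bound on the number U of (j+3)-cliques outside a fixed clique K in terms of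
-- the number M of (j+2)-cliques outside K, reached by adding the vertices outside K one at a time.
-- Once M reaches n C (j+1), that many cliques are paid for as if they came from one vertex with
-- n neighbours in K.
data State (r j n M U : ℕ) : Set where
  below : M < tur (2 + r) (1 + j) n → Sh (1 + r) (2 + j) U M → Sh (2 + r) (2 + j) U M → State r j n M U
  above : ∀ W → tur (2 + r) (1 + j) n ≤ M → U ≤ tur (2 + r) (2 + j) n + W →
          Sh (2 + r) (2 + j) W (M ∸ tur (2 + r) (1 + j) n) → State r j n M U

-- Here `x` and `y` count the cliques through the added vertex on the levels of `M` and `U`. Bounds
-- with `1 + r` parts are carried along because `cone` raises the number of parts by one.
advance : ∀ {r j n M U x y} → n ≤ 1 + r → State r j n M U →
  Sh (1 + r) (2 + j) y x → Sh (2 + r) (2 + j) y x →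
  y ≤ tur (2 + r) (2 + j) n + M → y ≤ tur (2 + r) (2 + j) (suc n) → State r j n (x + M) (y + U)
advance {r} {j} {n} {M} {U} {x} {y} n≤ (above W t≤M U≤ S) Y′ Y y≤ y≤⁺ = above (y + W) (≤-trans t≤M (m≤n+m M x))
  (≤-trans (+-monoʳ-≤ y U≤) (≤-reflexive (lemma y _ W)))
  (subst (Sh (2 + r) (2 + j) (y + W)) (sym (+-∸-assoc x t≤M)) (Sum.Sh-+ (1 + r) (1 + j) Y S))
  where
  lemma : ∀ a b c → a + (b + c) ≡ b + (a + c)
  lemma = solve-∀
advance {r} {j} {n} {M} {U} {x} {y} n≤ (below M<t S′ S) Y′ Y y≤ y≤⁺
  with ≤-<-connex (tur (2 + r) (1 + j) n) (x + M) | ≤-<-connex (tur (2 + r) (1 + j) n) x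
... | inj₂ x+M<t | _ = below x+M<t (Sum.Sh-+ r (1 + j) Y′ S′) (Sum.Sh-+ (1 + r) (1 + j) Y S)
-- Neither count reaches the threshold but their sum does: exchange fills one full graph on `n`
-- vertices, and the excess becomes `W`.
... | inj₁ t≤x+M | inj₂ x<t = small (≤-<-connex (y + U) (tur (2 + r) (2 + j) n))
  where
  y≤t : y ≤ tur (2 + r) (2 + j) n
  y≤t = tur-shadow n Y (<⇒≤ x<t)
  U≤t : U ≤ tur (2 + r) (2 + j) n
  U≤t = tur-shadow n S (<⇒≤ M<t)
  small : _ → State r j n (x + M) (y + U)
  small (inj₁ le) = above 0 t≤x+M (≤-trans le (m≤m+n _ 0)) none
  small (inj₂ lt) with proj₂ (merge (2 + r) (2 + j) n y≤t U≤t Y S) lt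
  ... | v , W , v≤ = above _ t≤x+M (≤-reflexive (sym (m+[n∸m]≡n (<⇒≤ lt))))
    (Sh-mono (m+n≤o⇒m≤o∸n v (≤-trans (≤-reflexive (+-comm v _)) v≤)) W)
... | inj₁ t≤x+M | inj₁ t≤x with ≤-<-connex y (tur (2 + r) (2 + j) n)
-- The new vertex alone pays for the full graph, and all earlier cliques move into `W`.
... | inj₁ y≤t = above U t≤x+M (+-monoˡ-≤ U y≤t)
  (Sh-mono (≤-trans (m≤n+m M (x ∸ tur (2 + r) (1 + j) n)) (≤-reflexive (sym (+-∸-comm M t≤x)))) S)
-- The link exceeds the full graph by `δ`, and the bound on `y` in terms of `M` gives `δ ≤ M`. So
-- the excess is one cone vertex over the earlier cliques.
... | inj₂ t<y with Sh-at n (y ∸ tur (2 + r) (2 + j) n) (sym (m+[n∸m]≡n (<⇒≤ t<y))) (m<n⇒0<n∸m t<y)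
                    (m≤n+o⇒m∸n≤o y _ y≤⁺) Y
... | v , D , v≤ = above (U + (δ + 0)) t≤x+M
  (≤-trans (+-monoˡ-≤ U (≤-reflexive (sym (m+[n∸m]≡n (<⇒≤ t<y)))))
    (≤-reflexive (trans (+-assoc (tur (2 + r) (2 + j) n) δ U)
      (cong (tur (2 + r) (2 + j) n +_) (trans (+-comm δ U) (cong (U +_) (sym (+-identityʳ δ))))))))
  (Sh-mono M+v≤ (cone (1 + r) (1 + j) n ((δ , v) ∷ [])
    (≤-trans (<⇒≤ M<t) (≤-reflexive (trans (tur-C (2 + r) (1 + j) n (m≤n⇒m≤1+n n≤)) (sym (tur-C (1 + r) (1 + j) n n≤)))))
    S′ ((m≤n+o⇒m∸n≤o y _ y≤ , D) ∷ [])))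
  where
  δ = y ∸ tur (2 + r) (2 + j) n
  M+v≤ : M + (v + 0) ≤ x + M ∸ tur (2 + r) (1 + j) n
  M+v≤ = begin
    M + (v + 0)                        ≡⟨ cong (M +_) (+-identityʳ v) ⟩
    M + v                              ≤⟨ +-monoʳ-≤ M (m+n≤o⇒m≤o∸n v (≤-trans (≤-reflexive (+-comm v _)) v≤)) ⟩
    M + (x ∸ tur (2 + r) (1 + j) n)    ≡⟨ +-comm M _ ⟩
    x ∸ tur (2 + r) (1 + j) n + M      ≡⟨ sym (+-∸-comm M t≤x) ⟩
    x + M ∸ tur (2 + r) (1 + j) n      ∎
    where open ≤-Reasoning

-- Binomial sums as Turán cascades

sum1-sum0 : ∀ t f → sum1 (suc t) f ≡ sum0 t (f ∘ suc)
sum1-sum0 zero    f = refl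
sum1-sum0 (suc t) f = cong (_+ f (suc (suc t))) (sum1-sum0 t f)

sum0-cong : ∀ s {f h} → (∀ j → j ≤ s → f j ≡ h j) → sum0 s f ≡ sum0 s h
sum0-cong zero    eq = eq 0 z≤n
sum0-cong (suc s) eq = cong₂ _+_ (sum0-cong s (λ j j≤s → eq j (m≤n⇒m≤1+n j≤s))) (eq (suc s) ≤-refl)

Decreasing : (ℕ → ℕ) → ℕ → Set
Decreasing a t = ∀ j → 1 ≤ j → j < t → a (suc j) < a j

decreasing≤ : ∀ a t → Decreasing a t → ∀ j → j < t → a (suc j) ≤ a 1
decreasing≤ a t dec zero    _   = ≤-refl
decreasing≤ a t dec (suc j) j<t = ≤-trans (<⇒≤ (dec (suc j) (s≤s z≤n) j<t)) (decreasing≤ a t dec j (<⇒≤ j<t))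

-- For `r` this large every quotient in `Descending` is 0 and every Turán number is a binomial
-- coefficient, so `cascade-shadow` applies.
binomial-shadow : ∀ r j t a {u m} → a 1 + t ≤ r → t ≤ 1 + j → Decreasing a t → Sh (2 + r) (2 + j) u m →
  m ≤ sum1 t (λ i → a i C (2 + j ∸ i)) → u ≤ sum1 t (λ i → a i C (3 + j ∸ i))
binomial-shadow r j zero a {zero} _ _ _ S m≤ = z≤n
binomial-shadow r j zero a {suc u} _ _ _ S z≤n with Sh-pos S (s≤s z≤n)
... | ()
binomial-shadow r j (suc s) a big s<j dec S m≤ = ≤-trans
  (cascade-shadow s (2 + r) (1 + j) (a ∘ suc) (m≤n⇒m≤1+n (m≤n⇒m≤1+n (m+n≤o⇒n≤o (a 1) big))) s<j desc S
    (≤-trans m≤ (≤-reflexive (as-cascade 1))))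
  (≤-reflexive (sym (as-cascade 2)))
  where
  small : ∀ x → x ≤ s → a (suc x) < 2 + r ∸ x
  small x x≤s = m+n≤o⇒m≤o∸n (suc (a (suc x))) (begin
    suc (a (suc x)) + x   ≤⟨ s≤s (+-mono-≤ (decreasing≤ a (suc s) dec x (s≤s x≤s)) (m≤n⇒m≤1+n x≤s)) ⟩
    suc (a 1 + suc s)     ≤⟨ s≤s big ⟩
    suc r                 ≤⟨ n≤1+n _ ⟩
    2 + r                 ∎)
    where open ≤-Reasoning
  as-cascade : ∀ d → sum1 (suc s) (λ i → a i C (d + suc j ∸ i)) ≡ cascade (2 + r) (d + j) (a ∘ suc) s
  as-cascade d = trans (sum1-sum0 s _) (sum0-cong s λ x x≤s →
    trans (cong (λ l → a (suc x) C (l ∸ suc x)) (+-suc d j)) (sym (tur-C (2 + r ∸ x) (d + j ∸ x) (a (suc x)) (<⇒≤ (small x x≤s)))))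
  div0 : ∀ {b} q → b < q → b div q ≡ 0
  div0 (suc q) b<q = m<n⇒m/n≡0 b<q
  desc : Descending (2 + r) (a ∘ suc) s
  desc x x<s = ≤-trans (dec (suc x) (s≤s z≤n) (s≤s x<s))
    (≤-reflexive (cong (a (suc x) ∸_) (sym (div0 (2 + r ∸ x) (small x (<⇒≤ x<s))))))

-- Adding vertices to a fixed clique

module WithClique {A : Set} (adj : A → A → Bool) (adj-sym : ∀ u v → adj u v ≡ adj v u)
  (adj-irrefl : ∀ v → adj v v ≡ false) (K : List A) (clique : Cliques.IsCliqueList adj K) where

  open Cliques adj

  -- With at least as many parts as vertices, clique-freeness is automatic: this is Kruskal-Katona
  -- without colours.
  piece-shadow : ∀ r k (p : A → Bool) l → length l ≤ r → Sh r (suc k) (cc (suc k) (filterᵇ p l)) (cc k (filterᵇ p l))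
  piece-shadow r k p l l≤ = clique-shadow adj-sym adj-irrefl r k (filterᵇ p l)
    (cc-length (suc r) (filterᵇ p l) (s≤s (≤-trans (length-filter (T? ∘ p) l) l≤)))

  beyond-shadow : ∀ r k O → length (O ++ K) ≤ suc r → Sh (suc r) (suc k) (beyond K (2 + k) O) (beyond K (1 + k) O)
  beyond-shadow r k []      _  = none
  beyond-shadow r k (w ∷ O) l≤ = Sum.Sh-+ r k (piece-shadow (suc r) k (adj w) (O ++ K) (<⇒≤ l≤)) (beyond-shadow r k O (<⇒≤ l≤))

  Degrees≤ : ℕ → List A → Set
  Degrees≤ n = All (λ w → length (filterᵇ (adj w) K) ≤ n)

  cc-neighbours : ∀ k w → cc k (filterᵇ (adj w) K) ≡ length (filterᵇ (adj w) K) C k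
  cc-neighbours k w = cc-clique k (AllPairs.filter⁺ (T? ∘ adj w) clique)

  -- More than `n` neighbours in `K` would alone give `suc n C suc k` cliques through `w`.
  degrees : ∀ k n O → beyond K (2 + k) O < suc n C suc k → Degrees≤ n O
  degrees k n []      _  = []
  degrees k n (w ∷ O) lt = ≮⇒≥ (λ n<d → <⇒≱ lt (begin
      suc n C suc k                                  ≤⟨ C-mono (suc k) n<d ⟩
      length (filterᵇ (adj w) K) C suc k             ≡⟨ sym (cc-neighbours (suc k) w) ⟩
      cc (suc k) (filterᵇ (adj w) K)                 ≤⟨ cc-⊆ (suc k) (filterᵇ-⊆ (adj w) (⊆-++ˡ O)) ⟩
      cc (suc k) (filterᵇ (adj w) (O ++ K))          ≤⟨ m≤m+n _ _ ⟩
      beyond K (2 + k) (w ∷ O)                       ∎))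
    ∷ degrees k n O (≤-<-trans (m≤n+m _ _) lt)
    where open ≤-Reasoning

  state : ∀ r j n O → n ≤ 1 + r → length (O ++ K) ≤ 1 + r → Degrees≤ n O →
    beyond K (3 + j) O ≤ tur (2 + r) (2 + j) (suc n) → State r j n (beyond K (2 + j) O) (beyond K (3 + j) O)
  state r j n [] n≤ l≤ [] _ with ≤-<-connex (tur (2 + r) (1 + j) n) 0
  -- For `n < 1 + j` the threshold is 0, reached before any vertex is added.
  ... | inj₁ t≤0 = above 0 t≤0 z≤n none
  ... | inj₂ 0<t = below 0<t none none
  state r j n (w ∷ O) n≤ l≤ (d≤n ∷ ds) le = advance n≤
    (state r j n O n≤ (<⇒≤ l≤) ds (≤-trans (m≤n+m _ _) le))
    (piece-shadow (1 + r) (1 + j) (adj w) (O ++ K) (<⇒≤ l≤))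
    (piece-shadow (2 + r) (1 + j) (adj w) (O ++ K) (m≤n⇒m≤1+n (<⇒≤ l≤)))
    (≤-trans (cc-filter-++ (adj w) K (1 + j) O) (+-monoˡ-≤ (beyond K (2 + j) O) (begin
      cc (2 + j) (filterᵇ (adj w) K)          ≡⟨ cc-neighbours (2 + j) w ⟩
      length (filterᵇ (adj w) K) C (2 + j)    ≤⟨ C-mono (2 + j) d≤n ⟩
      n C (2 + j)                             ≡⟨ sym (tur-C (2 + r) (2 + j) n (m≤n⇒m≤1+n n≤)) ⟩
      tur (2 + r) (2 + j) n                   ∎)))
    (≤-trans (m≤m+n _ _) le)
    where open ≤-Reasoning

  -- Induction on `l`, together with a cap by the full graph on `suc n` vertices, which `advance`
  -- needs to open a link at `n`. The degree bound comes from the lowest level and serves all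
  -- others.
  beyond-bound : ∀ k n t a O → beyond K (2 + k) O ≡ n C (1 + k) + sum1 t (λ i → a i C (2 + k ∸ i)) →
    Decreasing a t → t ≤ 1 + k → sum1 t (λ i → a i C (2 + k ∸ i)) < n C k →
    ∀ l → beyond K (2 + k + l) O ≤ n C (1 + k + l) + sum1 t (λ i → a i C (2 + k + l ∸ i))
  beyond-bound k n t a O rep dec t≤ Σ< l = proj₁ (go l)
    where
    -- Large enough that the Turán numbers met here are binomial coefficients and `piece-shadow`
    -- applies to every link.
    r = length (O ++ K) + n + (a 1 + t)
    Σ : ℕ → ℕ
    Σ l = sum1 t (λ i → a i C (2 + k + l ∸ i))
    n≤ : n ≤ r
    n≤ = ≤-trans (m≤n+m n (length (O ++ K))) (m≤m+n _ (a 1 + t))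
    len≤ : length (O ++ K) ≤ r
    len≤ = ≤-trans (m≤m+n _ n) (m≤m+n _ (a 1 + t))
    start : beyond K (2 + k) O < suc n C suc k
    start = begin-strict
      beyond K (2 + k) O                                   ≡⟨ rep ⟩
      n C (1 + k) + sum1 t (λ i → a i C (2 + k ∸ i))       <⟨ +-monoʳ-< (n C (1 + k)) Σ< ⟩
      n C (1 + k) + n C k                                  ≡⟨ +-comm (n C (1 + k)) _ ⟩
      n C k + n C (1 + k)                                  ≡⟨ nCk+nC[k+1]≡[n+1]C[k+1] n k ⟩
      suc n C suc k                                        ∎
      where open ≤-Reasoning
    go : ∀ l → beyond K (2 + k + l) O ≤ n C (1 + k + l) + Σ l ×
               beyond K (2 + k + l) O ≤ tur (2 + r) (1 + k + l) (suc n)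
    go zero rewrite +-identityʳ k = ≤-reflexive rep ,
      ≤-trans (<⇒≤ start) (≤-reflexive (sym (tur-C (2 + r) (1 + k) (suc n) (s≤s (m≤n⇒m≤1+n n≤)))))
    go (suc l) rewrite +-suc k l = bound (state r (k + l) n O (m≤n⇒m≤1+n n≤) (m≤n⇒m≤1+n len≤) (degrees k n O start) cap) , cap
      where
      cap : beyond K (3 + (k + l)) O ≤ tur (2 + r) (2 + (k + l)) (suc n)
      cap = tur-shadow (suc n) (beyond-shadow (1 + r) (1 + (k + l)) O (m≤n⇒m≤1+n (m≤n⇒m≤1+n len≤))) (proj₂ (go l))
      t₁≡ : ∀ j → tur (2 + r) j n ≡ n C j
      t₁≡ j = tur-C (2 + r) j n (m≤n⇒m≤1+n (m≤n⇒m≤1+n n≤))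
      bound : State r (k + l) n (beyond K (2 + (k + l)) O) (beyond K (3 + (k + l)) O) →
        beyond K (3 + (k + l)) O ≤ n C (2 + (k + l)) + sum1 t (λ i → a i C (3 + (k + l) ∸ i))
      bound (below M<t _ S) = ≤-trans (tur-shadow n S (<⇒≤ M<t)) (≤-trans (≤-reflexive (t₁≡ (2 + (k + l)))) (m≤m+n _ _))
      bound (above W t≤M U≤ S) = ≤-trans U≤ (+-mono-≤ (≤-reflexive (t₁≡ (2 + (k + l))))
        (binomial-shadow r (k + l) t a (m≤n+m (a 1 + t) (length (O ++ K) + n)) (≤-trans t≤ (s≤s (m≤m+n k l))) dec S
          (m≤n+o⇒m∸n≤o _ _ (≤-trans (proj₁ (go l)) (+-monoˡ-≤ (Σ l) (≤-reflexive (sym (t₁≡ (1 + (k + l))))))))))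

-- Counting cliques of graphs

cc : {A : Set} → (A → A → Bool) → ℕ → List A → ℕ
cc = Cliques.cc

filterᵇ-map : {A B : Set} (p : B → Bool) (f : A → B) (l : List A) → filterᵇ p (map f l) ≡ map f (filterᵇ (p ∘ f) l)
filterᵇ-map p f [] = refl
filterᵇ-map p f (x ∷ l) with p (f x)
... | true  = cong (f x ∷_) (filterᵇ-map p f l)
... | false = filterᵇ-map p f l

cc-map : {A B : Set} (adj : B → B → Bool) (f : A → B) → ∀ k l → cc adj k (map f l) ≡ cc (λ u v → adj (f u) (f v)) k l
cc-map adj f zero    l       = refl
cc-map adj f (suc k) []      = refl
cc-map adj f (suc k) (v ∷ l) = cong₂ _+_ (cc-map adj f (suc k) l)
  (trans (cong (cc adj k) (filterᵇ-map (adj (f v)) f l)) (cc-map adj f k _))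

filterᵇ-cong : {A : Set} {p q : A → Bool} → (∀ x → p x ≡ q x) → ∀ l → filterᵇ p l ≡ filterᵇ q l
filterᵇ-cong p≗q [] = refl
filterᵇ-cong {p = p} {q} p≗q (x ∷ l) rewrite p≗q x with q x
... | true  = cong (x ∷_) (filterᵇ-cong p≗q l)
... | false = filterᵇ-cong p≗q l

filterᵇ-∧ : {A : Set} (p q : A → Bool) (l : List A) → filterᵇ p (filterᵇ q l) ≡ filterᵇ (λ x → q x ∧ p x) l
filterᵇ-∧ p q [] = refl
filterᵇ-∧ p q (x ∷ l) with q x
... | false = filterᵇ-∧ p q l
... | true with p x
...   | true  = cong (x ∷_) (filterᵇ-∧ p q l)
...   | false = filterᵇ-∧ p q l

allᵇ-cong : {A : Set} {p q : A → Bool} → (∀ x → p x ≡ q x) → ∀ l → allᵇ p l ≡ allᵇ q l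
allᵇ-cong p≗q []      = refl
allᵇ-cong p≗q (x ∷ l) = cong₂ _∧_ (p≗q x) (allᵇ-cong p≗q l)

allᵇ-true : {A : Set} (l : List A) → allᵇ (λ _ → true) l ≡ true
allᵇ-true []      = refl
allᵇ-true (_ ∷ l) = allᵇ-true l

allᵇ-map : {A B : Set} (p : B → Bool) (f : A → B) (l : List A) → allᵇ p (map f l) ≡ allᵇ (p ∘ f) l
allᵇ-map p f []      = refl
allᵇ-map p f (x ∷ l) = cong (p (f x) ∧_) (allᵇ-map p f l)

∧-interchange : ∀ a b c d → (a ∧ b) ∧ (c ∧ d) ≡ (a ∧ c) ∧ (b ∧ d)
∧-interchange false b c     d = refl
∧-interchange true  b false d = ∧-zeroʳ b
∧-interchange true  b true  d = refl

allᵇ-∧ : {A : Set} (p q : A → Bool) (l : List A) → allᵇ p l ∧ allᵇ q l ≡ allᵇ (λ x → p x ∧ q x) l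
allᵇ-∧ p q []      = refl
allᵇ-∧ p q (x ∷ l) = trans (∧-interchange (p x) _ (q x) _) (cong ((p x ∧ q x) ∧_) (allᵇ-∧ p q l)) 

allFin-suc : ∀ n → allFin (suc n) ≡ zero ∷ map suc (allFin n)
allFin-suc n = cong (zero ∷_) (sym (map-tabulate id suc))

allᵇ-Fin : ∀ {n} (p : Fin (suc n) → Bool) → allᵇ p (allFin (suc n)) ≡ p zero ∧ allᵇ (p ∘ suc) (allFin n)
allᵇ-Fin {n} p = trans (cong (allᵇ p) (allFin-suc n)) (cong (p zero ∧_) (allᵇ-map p suc (allFin n)))

Adj : ℕ → Set
Adj n = Fin n → Fin n → Bool

tail : ∀ {n} → Adj (suc n) → Adj n
tail adj u v = adj (suc u) (suc v)

pairOK : ∀ {n} → Adj n → Subset n → Fin n → Fin n → Bool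
pairOK adj p u v = not (lookup p u ∧ lookup p v ∧ (toℕ u <ᵇ toℕ v)) ∨ adj u v

-- `isClique` with the adjacency as an argument, so that recursion can drop vertex zero.
cliqueᵇ : ∀ {n} → Adj n → Subset n → Bool
cliqueᵇ {n} adj p = allᵇ (λ u → allᵇ (pairOK adj p u) (allFin n)) (allFin n)

within : ∀ {n} → (Fin n → Bool) → Subset n → Bool
within {n} ok p = allᵇ (λ u → not (lookup p u) ∨ ok u) (allFin n)

cliqueᵇ-∷ : ∀ {n} (adj : Adj (suc n)) x p →
  cliqueᵇ adj (x ∷ p) ≡ allᵇ (λ u → not (x ∧ lookup p u ∧ true) ∨ adj zero (suc u)) (allFin n) ∧ cliqueᵇ (tail adj) p
cliqueᵇ-∷ {n} adj x p = trans (allᵇ-Fin (λ u → allᵇ (pairOK adj (x ∷ p) u) (allFin (suc n))))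
  (cong₂ _∧_ first (allᵇ-cong rest (allFin n)))
  where
  -- A pair failing the order test imposes no condition; this disposes of all pairs ending in vertex
  -- zero.
  ∨-false : ∀ a b c → not (a ∧ b ∧ false) ∨ c ≡ true
  ∨-false false b     c = refl
  ∨-false true  false c = refl
  ∨-false true  true  c = refl
  first : allᵇ (pairOK adj (x ∷ p) zero) (allFin (suc n)) ≡ allᵇ (λ u → not (x ∧ lookup p u ∧ true) ∨ adj zero (suc u)) (allFin n)
  first = trans (allᵇ-Fin (pairOK adj (x ∷ p) zero)) (cong (_∧ allᵇ (pairOK adj (x ∷ p) zero ∘ suc) (allFin n)) (∨-false x x (adj zero zero)))
  rest : ∀ u → allᵇ (pairOK adj (x ∷ p) (suc u)) (allFin (suc n)) ≡ allᵇ (pairOK (tail adj) p u) (allFin n)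
  rest u = trans (allᵇ-Fin (pairOK adj (x ∷ p) (suc u))) (cong (_∧ allᵇ (pairOK (tail adj) p u) (allFin n)) (∨-false (lookup p u) x (adj (suc u) zero)))

cliqueᵇ-outside : ∀ {n} (adj : Adj (suc n)) p → cliqueᵇ adj (outside ∷ p) ≡ cliqueᵇ (tail adj) p
cliqueᵇ-outside {n} adj p = trans (cliqueᵇ-∷ adj outside p) (cong (_∧ cliqueᵇ (tail adj) p) (allᵇ-true (allFin n)))

cliqueᵇ-inside : ∀ {n} (adj : Adj (suc n)) p → cliqueᵇ adj (inside ∷ p) ≡ within (adj zero ∘ suc) p ∧ cliqueᵇ (tail adj) p
cliqueᵇ-inside {n} adj p = trans (cliqueᵇ-∷ adj inside p)
  (cong (_∧ cliqueᵇ (tail adj) p) (allᵇ-cong (λ u → cong (λ b → not b ∨ adj zero (suc u)) (∧-comm (lookup p u) true)) (allFin n)))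

within-∧ : ∀ {n} (ok ok′ : Fin n → Bool) p → within ok p ∧ within ok′ p ≡ within (λ u → ok u ∧ ok′ u) p
within-∧ {n} ok ok′ p = trans (allᵇ-∧ _ _ (allFin n)) (allᵇ-cong (λ u → lemma (lookup p u) (ok u) (ok′ u)) (allFin n))
  where
  lemma : ∀ x a b → (not x ∨ a) ∧ (not x ∨ b) ≡ not x ∨ (a ∧ b)
  lemma false a b = refl
  lemma true  a b = refl

count : {A : Set} → (A → Bool) → List A → ℕ
count p l = length (filterᵇ p l)

count-none : {A : Set} (p : A → Bool) → (∀ x → p x ≡ false) → ∀ l → count p l ≡ 0
count-none p p≡f []      = refl
count-none p p≡f (x ∷ l) rewrite p≡f x = count-none p p≡f l

count-cong : {A : Set} {p q : A → Bool} → (∀ x → p x ≡ q x) → ∀ l → count p l ≡ count q l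
count-cong p≗q l = cong length (filterᵇ-cong p≗q l)

count-subsets : ∀ {n} (p : Subset (suc n) → Bool) →
  count p (allSubsets (suc n)) ≡ count (p ∘ (outside ∷_)) (allSubsets n) + count (p ∘ (inside ∷_)) (allSubsets n)
count-subsets {n} p = begin
  length (filterᵇ p (map (outside ∷_) S ++ map (inside ∷_) S))              ≡⟨ cong length (filter-++ (T? ∘ p) (map (outside ∷_) S) _) ⟩
  length (filterᵇ p (map (outside ∷_) S) ++ filterᵇ p (map (inside ∷_) S))  ≡⟨ length-++ (filterᵇ p (map (outside ∷_) S)) ⟩
  count p (map (outside ∷_) S) + count p (map (inside ∷_) S)                ≡⟨ cong₂ _+_ (count-map (outside ∷_)) (count-map (inside ∷_)) ⟩
  count (p ∘ (outside ∷_)) S + count (p ∘ (inside ∷_)) S                    ∎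
  where
  open ≡-Reasoning
  S = allSubsets n
  count-map : (f : Subset n → Subset (suc n)) → count p (map f S) ≡ count (p ∘ f) S
  count-map f = trans (cong length (filterᵇ-map p f S)) (length-map f (filterᵇ (p ∘ f) S))

-- The predicate `ok` carries the induction: in a clique containing vertex zero, the other vertices
-- must also be neighbours of zero.
count-cliques : ∀ {n} (adj : Adj n) k (ok : Fin n → Bool) →
  count (λ p → (∣ p ∣ ≡ᵇ k) ∧ cliqueᵇ adj p ∧ within ok p) (allSubsets n) ≡ cc adj k (filterᵇ ok (allFin n))
count-cliques {zero}  adj zero    ok = refl
count-cliques {zero}  adj (suc k) ok = refl
count-cliques {suc n} adj k ok = begin
  count Q (allSubsets (suc n))                                ≡⟨ count-subsets Q ⟩
  count (Q ∘ (outside ∷_)) S + count (Q ∘ (inside ∷_)) S      ≡⟨ cong₂ _+_ out≡ (in≡ k (ok zero) refl) ⟩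
  cc adj k (map suc F) + with0 k (ok zero)                    ≡⟨ total k (ok zero) refl ⟩
  cc adj k (filterᵇ ok (allFin (suc n)))                      ∎
  where
  open ≡-Reasoning
  S = allSubsets n
  Q : Subset (suc n) → Bool
  Q p = (∣ p ∣ ≡ᵇ k) ∧ cliqueᵇ adj p ∧ within ok p
  F : List (Fin n)
  F = filterᵇ (ok ∘ suc) (allFin n)
  with0 : ℕ → Bool → ℕ
  with0 zero    _     = 0
  with0 (suc k) false = 0
  with0 (suc k) true  = cc adj k (filterᵇ (adj zero) (map suc F))
  within-∷ : ∀ x p → within ok (x ∷ p) ≡ (not x ∨ ok zero) ∧ within (ok ∘ suc) p
  within-∷ x p = allᵇ-Fin (λ u → not (lookup (x ∷ p) u) ∨ ok u)
  out≡ : count (Q ∘ (outside ∷_)) S ≡ cc adj k (map suc F)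
  out≡ = trans (count-cong (λ p → cong₂ (λ a b → (∣ p ∣ ≡ᵇ k) ∧ a ∧ b) (cliqueᵇ-outside adj p) (within-∷ outside p)) S)
    (trans (count-cliques (tail adj) k (ok ∘ suc)) (sym (cc-map adj suc k F)))
  in≡ : ∀ k b → ok zero ≡ b → count (λ p → (suc ∣ p ∣ ≡ᵇ k) ∧ cliqueᵇ adj (inside ∷ p) ∧ within ok (inside ∷ p)) S ≡ with0 k b
  in≡ zero _ _ = count-none _ (λ _ → refl) S
  in≡ (suc k) false ok0 = count-none _ (λ p → trans (cong (λ b → (∣ p ∣ ≡ᵇ k) ∧ cliqueᵇ adj (inside ∷ p) ∧ b)
      (trans (within-∷ inside p) (cong (_∧ within (ok ∘ suc) p) ok0)))
      (trans (cong ((∣ p ∣ ≡ᵇ k) ∧_) (∧-zeroʳ _)) (∧-zeroʳ _))) S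
  in≡ (suc k) true ok0 = trans (count-cong (λ p → cong ((∣ p ∣ ≡ᵇ k) ∧_) (body p)) S)
    (trans (count-cliques (tail adj) k (λ u → ok (suc u) ∧ adj zero (suc u)))
    (trans (cong (cc (tail adj) k) (sym (filterᵇ-∧ (adj zero ∘ suc) (ok ∘ suc) (allFin n))))
    (trans (sym (cc-map adj suc k _)) (cong (cc adj k) (sym (filterᵇ-map (adj zero) suc F))))))
    where
    body : ∀ p → cliqueᵇ adj (inside ∷ p) ∧ within ok (inside ∷ p) ≡ cliqueᵇ (tail adj) p ∧ within (λ u → ok (suc u) ∧ adj zero (suc u)) p
    body p = begin
      cliqueᵇ adj (inside ∷ p) ∧ within ok (inside ∷ p)
        ≡⟨ cong₂ _∧_ (trans (cliqueᵇ-inside adj p) (∧-comm (within (adj zero ∘ suc) p) _))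
             (trans (within-∷ inside p) (cong (_∧ within (ok ∘ suc) p) ok0)) ⟩
      (cliqueᵇ (tail adj) p ∧ within (adj zero ∘ suc) p) ∧ within (ok ∘ suc) p
        ≡⟨ ∧-assoc (cliqueᵇ (tail adj) p) _ _ ⟩
      cliqueᵇ (tail adj) p ∧ (within (adj zero ∘ suc) p ∧ within (ok ∘ suc) p)
        ≡⟨ cong (cliqueᵇ (tail adj) p ∧_) (trans (∧-comm (within (adj zero ∘ suc) p) _) (within-∧ (ok ∘ suc) (adj zero ∘ suc) p)) ⟩
      cliqueᵇ (tail adj) p ∧ within (λ u → ok (suc u) ∧ adj zero (suc u)) p ∎
  split : ∀ b → ok zero ≡ b → filterᵇ ok (allFin (suc n)) ≡ (if b then zero ∷ map suc F else map suc F)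
  split b ok0 = trans (cong (filterᵇ ok) (allFin-suc n)) (head b ok0)
    where
    head : ∀ b → ok zero ≡ b → filterᵇ ok (zero ∷ map suc (allFin n)) ≡ (if b then zero ∷ map suc F else map suc F)
    head false ok0 rewrite ok0 = filterᵇ-map ok suc (allFin n)
    head true  ok0 rewrite ok0 = cong (zero ∷_) (filterᵇ-map ok suc (allFin n))
  total : ∀ k b → ok zero ≡ b → cc adj k (map suc F) + with0 k b ≡ cc adj k (filterᵇ ok (allFin (suc n)))
  total zero    _     _   = refl
  total (suc k) false ok0 = trans (+-identityʳ _) (cong (cc adj (suc k)) (sym (split false ok0)))
  total (suc k) true  ok0 = cong (cc adj (suc k)) (sym (split true ok0))

c≡cc : ∀ k G → c k G ≡ cc (Graph.adj G) k (allFin (Graph.n G))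
c≡cc k G = trans (count-cong (λ p → cong ((∣ p ∣ ≡ᵇ k) ∧_) (sym (trans (cong (isClique G p ∧_) (all-within p)) (∧-comm (isClique G p) true)))) (allSubsets (Graph.n G)))
  (trans (count-cliques (Graph.adj G) k (λ _ → true)) (cong (cc (Graph.adj G) k) (filter-all _ (All.universal (λ _ → _) (allFin (Graph.n G))))))
  where
  all-within : ∀ p → within (λ _ → true) p ≡ true
  all-within p = trans (allᵇ-cong (λ u → ∨-true (not (lookup p u))) (allFin (Graph.n G))) (allᵇ-true (allFin (Graph.n G)))
    where
    ∨-true : ∀ b → b ∨ true ≡ true
    ∨-true false = refl
    ∨-true true  = refl

-- Cliques of Turán graphs

diff : ℕ → ℕ → Bool
diff x y = not (x ≡ᵇ y)

diff-sym : ∀ x y → diff x y ≡ diff y x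
diff-sym x y = cong not (≡ᵇ-sym x y)

-- Vertices are replaced by their colours, with `diff` as adjacency. The empty list for no parts
-- agrees with `tur zero`.
colours : ℕ → ℕ → List ℕ
colours zero    b = []
colours (suc r) b = applyDownFrom (_% suc r) b

-- Gathers the last colour class, an independent set joined to everything else, so that counts
-- follow `tur-slice`.
colours-split : ∀ r b → colours (suc r) b ↭ replicate (b / suc r) r ++ colours r (nbrs r b)
colours-split zero    zero = refl
colours-split (suc r) zero = refl
colours-split r (suc b) with next r b
... | stay g≡ q≡ m≡ rewrite g≡ | q≡ | m≡ = prep r (colours-split r b)
colours-split (suc r) (suc b) | grow g≡ q≡ _ m≡ rewrite g≡ | q≡ | m≡ =
  ↭-trans (prep _ (colours-split (suc r) b)) (↭-sym (shift _ (replicate (b / suc (suc r)) (suc r)) _))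

cc-replicate : ∀ x k m l → All (λ y → diff x y ≡ true) l → cc diff (suc k) (replicate m x ++ l) ≡ cc diff (suc k) l + m * cc diff k l
cc-replicate x k zero    l al = sym (+-identityʳ _)
cc-replicate x k (suc m) l al = trans (cong₂ _+_ (cc-replicate x k m l al) (cong (cc diff k) (others m)))
  (+-rotate (cc diff (suc k) l) (m * cc diff k l) _)
  where
  others : ∀ m → filterᵇ (diff x) (replicate m x ++ l) ≡ l
  others zero    = filter-all (T? ∘ diff x) (All.map (Equivalence.from T-≡) al)
  others (suc m) rewrite ≡ᵇ-refl x = others m

diff-< : ∀ {x y} → y < x → diff x y ≡ true
diff-< {suc x} {zero}  _         = refl
diff-< {suc x} {suc y} (s≤s y<x) = diff-< y<x

cc-colours : ∀ r k b → cc diff k (colours r b) ≡ tur r k b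
cc-colours r       zero    b = refl
cc-colours zero    (suc k) b = refl
cc-colours (suc r) (suc k) b = begin
  cc diff (suc k) (colours (suc r) b)                                           ≡⟨ Cliques.cc-↭ diff diff-sym (suc k) (colours-split r b) ⟩
  cc diff (suc k) (replicate (b / suc r) r ++ colours r (nbrs r b))             ≡⟨ cc-replicate r k (b / suc r) _ (distinct r) ⟩
  cc diff (suc k) (colours r (nbrs r b)) + b / suc r * cc diff k (colours r (nbrs r b))
    ≡⟨ cong₂ (λ x y → x + b / suc r * y) (cc-colours r (suc k) (nbrs r b)) (cc-colours r k (nbrs r b)) ⟩
  tur r (suc k) (nbrs r b) + b / suc r * tur r k (nbrs r b)                     ≡⟨ sym (tur-slice r (suc k) b) ⟩
  tur (suc r) (suc k) b                                                         ∎
  where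
  open ≡-Reasoning
  distinct : ∀ r {b} → All (λ y → diff r y ≡ true) (colours r b)
  distinct zero        = []
  distinct (suc r) {b} = All.applyDownFrom⁺₂ (_% suc r) b (λ i → diff-< (m%n<n i (suc r)))

tabulate-↭ : {A : Set} (f : ℕ → A) → ∀ n → tabulate {n = n} (f ∘ toℕ) ↭ applyDownFrom f n
tabulate-↭ f zero    = refl
tabulate-↭ f (suc n) = ↭-trans (prep (f 0) (tabulate-↭ (f ∘ suc) n)) (rotate n)
  where
  rotate : ∀ n → f 0 ∷ applyDownFrom (f ∘ suc) n ↭ applyDownFrom f (suc n)
  rotate zero    = refl
  rotate (suc n) = ↭-trans (swap (f 0) (f (suc n)) ↭-refl) (prep (f (suc n)) (rotate n))

turanC≡tur : ∀ b k r → 1 ≤ r → turanC b k r ≡ tur r k b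
turanC≡tur b k (suc r) _ = begin
  c k (Turán b (suc r))                                          ≡⟨ c≡cc k (Turán b (suc r)) ⟩
  cc (λ u v → diff (colour u) (colour v)) k (allFin b)           ≡⟨ sym (cc-map diff colour k (allFin b)) ⟩
  cc diff k (map colour (allFin b))                              ≡⟨ cong (cc diff k) (map-tabulate id colour) ⟩
  cc diff k (tabulate colour)                                    ≡⟨ Cliques.cc-↭ diff diff-sym k (tabulate-↭ (_% suc r) b) ⟩
  cc diff k (colours (suc r) b)                                  ≡⟨ cc-colours (suc r) k b ⟩
  tur (suc r) k b                                                ∎
  where
  open ≡-Reasoning
  colour : Fin b → ℕ
  colour u = toℕ u % suc r

-- The two bounds and the theorem

clique-bound : ∀ k l G nk n t a → 1 ≤ c nk G →
  c (2 + k) G ≡ nk C (2 + k) + n C (1 + k) + sum1 t (λ j → a j C (2 + k ∸ j)) →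
  Decreasing a t → t ≤ 1 + k → sum1 t (λ j → a j C (2 + k ∸ j)) < n C k →
  c (2 + k + l) G ≤ nk C (2 + k + l) + n C (1 + k + l) + sum1 t (λ j → a j C (2 + k + l ∸ j))
clique-bound k l G nk n′ t a 1≤c rep dec t≤ Σ<
  with Cliques.find-clique (Graph.adj G) nk (allFin (Graph.n G)) (≤-trans 1≤c (≤-reflexive (c≡cc nk G)))
... | K , O , l↭ , refl , clique = begin
  c (2 + k + l) G                                  ≡⟨ c≡ (k + l) ⟩
  nk C (2 + k + l) + beyond K (2 + k + l) O        ≤⟨ +-monoʳ-≤ (nk C (2 + k + l)) (beyond-bound k n′ t a O rep′ dec t≤ Σ< l) ⟩
  nk C (2 + k + l) + (n′ C (1 + k + l) + Σ l)      ≡⟨ sym (+-assoc (nk C (2 + k + l)) _ _) ⟩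
  nk C (2 + k + l) + n′ C (1 + k + l) + Σ l        ∎
  where
  open ≤-Reasoning
  open Cliques (Graph.adj G) using (beyond)
  open WithClique (Graph.adj G) (Graph.sym G) (Graph.irrefl G) K clique using (beyond-bound)
  Σ : ℕ → ℕ
  Σ l = sum1 t (λ j → a j C (2 + k + l ∸ j))
  c≡ : ∀ j → c (2 + j) G ≡ length K C (2 + j) + beyond K (2 + j) O
  c≡ j = trans (c≡cc (2 + j) G) (trans (Cliques.cc-↭ (Graph.adj G) (Graph.sym G) (2 + j) l↭)
    (trans (Cliques.cc-++ (Graph.adj G) K (1 + j) O) (cong (_+ beyond K (2 + j) O) (Cliques.cc-clique (Graph.adj G) (2 + j) clique))))
  rep′ : beyond K (2 + k) O ≡ n′ C (1 + k) + sum1 t (λ j → a j C (2 + k ∸ j))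
  rep′ = +-cancelˡ-≡ (length K C (2 + k)) _ _ (trans (sym (c≡ k)) (trans rep (+-assoc (length K C (2 + k)) _ _)))

turan-bound : ∀ r k G s b → c (suc r) G ≡ 0 → k ≤ r → s < k →
  c k G ≡ sum0 s (λ j → turanC (b j) (k ∸ j) (r ∸ j)) → Descending r b s →
  ∀ l → c (k + l) G ≤ sum0 s (λ j → turanC (b j) (k + l ∸ j) (r ∸ j))
turan-bound r k G s b free k≤r s<k rep desc l = ≤-trans (go l) (≤-reflexive (sym (as-cascade (k + l))))
  where
  as-cascade : ∀ k → sum0 s (λ j → turanC (b j) (k ∸ j) (r ∸ j)) ≡ cascade r k b s
  as-cascade k = sum0-cong s (λ j j≤s → turanC≡tur (b j) (k ∸ j) (r ∸ j) (m<n⇒0<n∸m (≤-<-trans j≤s (<-≤-trans s<k k≤r))))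
  go : ∀ l → c (k + l) G ≤ cascade r (k + l) b s
  go zero rewrite +-identityʳ k = ≤-reflexive (trans rep (as-cascade k))
  go (suc l) rewrite +-suc k l = cascade-shadow s r (k + l) b (<-≤-trans s<k k≤r) (<-≤-trans s<k (m≤m+n k l)) desc
    (subst₂ (Sh r (suc (k + l))) (sym (c≡cc (suc (k + l)) G)) (sym (c≡cc (k + l) G))
      (Cliques.clique-shadow (Graph.adj G) (Graph.sym G) (Graph.irrefl G) r (k + l) (allFin (Graph.n G))
        (trans (sym (c≡cc (suc r) G)) free)))
    (go l)

theorem5p1 : (k i : ℕ) → 1 ≤ k → 1 ≤ i → (G : Graph) → 1 ≤ c k G →
    (nk nk1 t : ℕ) (a : ℕ → ℕ) →
    c k G ≡ nk C k + nk1 C (k ∸ 1) + sum1 t (λ j → a j C (k ∸ j)) →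
    nk1 < nk →
    k ≤ nk1 + 2 →
    (∀ j → 1 ≤ j → j < t → a (suc j) < a j) →
    (1 ≤ t → k ≤ a t + t) →
    t < k →
    sum1 t (λ j → a j C (k ∸ j)) < chooseSub nk1 k 2 →
    (nk ≡ k →
    c (k + i) G ≤ nk C (k + i) + nk1 C (k + i ∸ 1) + sum1 t (λ j → a j C (k + i ∸ j)))
    ×
    (k < nk → (s : ℕ) (b : ℕ → ℕ) →
    c k G ≡ sum0 s (λ j → turanC (b j) (k ∸ j) (nk ∸ 1 ∸ j)) →
    (∀ j → j < s → b (suc j) < b j ∸ (b j div (nk ∸ 1 ∸ j))) →
    s < k →
    k ≤ b s + s →
    c (k + i) G ≤ (nk C (k + i) + nk1 C (k + i ∸ 1) + sum1 t (λ j → a j C (k + i ∸ j)))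
    ⊔ sum0 s (λ j → turanC (b j) (k + i ∸ j) (nk ∸ 1 ∸ j)))
-- For `k = 1` the sum would have to be below `chooseSub nk1 1 2`, which is 0.
theorem5p1 (suc zero) i _ _ G _ nk nk1 t a _ _ _ _ _ _ ()
theorem5p1 (suc (suc k)) i _ _ G 1≤c nk nk1 t a rep _ _ dec _ (s≤s t≤) Σ< = first , second
  where
  with-clique : 1 ≤ c nk G → _
  with-clique 1≤ = clique-bound k i G nk nk1 t a 1≤ rep dec t≤ Σ<
  first : nk ≡ suc (suc k) → _
  -- When `nk = k`, the assumed `k`-clique is the large clique.
  first refl = with-clique 1≤c
  second : suc (suc k) < nk → _
  second k<nk s b rep′ desc s<k _ with c nk G in free
  ... | suc _ = ≤-trans (with-clique (≤-trans (s≤s z≤n) (≤-reflexive (sym free)))) (m≤m⊔n _ _)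
  -- Here `nk = suc r` and `G` has no `suc r`-clique, so the coloured bound applies with `r` parts.
  second (s≤s {n = r} k≤r) s b rep′ desc s<k _ | zero =
    ≤-trans (turan-bound r (suc (suc k)) G s b free k≤r s<k rep′ desc i) (m≤n⊔m _ _)
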